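{- Let $(G,\tau,\partial)$ be a Polish topometric group admitting (topometric) ample generics. Then $G$ has the small density property: whenever $H\colon G \to [0,\infty]$ is a graded subgroup which is lower semi-continuous with respect to $\partial$ and whose index $[G:H]$ is strictly less than $2^{\aleph_0}$, $H$ is upper semi-continuous (and hence continuous) with respect to $\tau$.
   Context: A Polish topometric group is a triple $(G,\tau,\partial)$ where $(G,\tau)$ is a Polish group and $\partial$ is a complete bi-invariant metric on $G$ whose topology refines $\tau$ and which is $\tau$-lower semi-continuous, i.e. $\{(g,h)\colon \partial(g,h) \leq r\}$ is $\tau$-closed in $G \times G$ for every $r$. It has (topometric) ample generics if for every $n \in \mathbb{N}$ there is $(g_1,\ldots,g_n) \in G^n$ such that the $\partial$-closure (for the maximum metric on $G^n$) of $\{(kg_1k^{ -1},\ldots,kg_nk^{ -1}) \colon k \in G\}$ is co-meagre in $(G^n,\tau)$. A graded subgroup is a function $H\colon G \to [0,\infty]$ with $H(1)=0$, $H(x)=H(x^{ -1})$ and $H(hg)\leq H(h)+H(g)$ for all $g,h$. It defines the left-invariant pseudo-metric $d_H(g,h) = H(g^{ -1}h)$ (possibly taking value $\infty$), and the index $[G:H]$ is the density character of $d_H$, i.e. the least cardinality of a $d_H$-dense subset of $G$. $H$ is $\partial$-closed if it is lower semi-continuous for the topology of $\partial$. -}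

module Defs where

open import Algebra.Bundles using (Group)
open import Data.Bool.Base using (Bool)
open import Data.Empty using (⊥)
open import Data.Fin.Base using (Fin; zero; suc)
open import Data.List.Base using (List)
open import Data.List.Relation.Unary.All using (All)
open import Data.Nat.Base using (ℕ; zero; suc) renaming (_≤_ to _≤ℕ_)
open import Data.Product.Base using (Σ; Σ-syntax; ∃; ∃-syntax; _×_; _,_; proj₁; proj₂; uncurry)
open import Data.Product.Relation.Binary.Pointwise.NonDependent using (×-setoid)
open import Data.Rational.Base as ℚ using (ℚ; 0ℚ; 1ℚ)
import Data.Rational.Properties as ℚ
open import Data.Sum.Base using (_⊎_; inj₁; inj₂)
open import Data.Vec.Functional using (foldr)
import Data.Vec.Functional.Relation.Binary.Equality.Setoid as VecEq
open import Function.Bundles using (Func; Injection; Surjection)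
open import Function.Metric.Structures using (IsGeneralMetric)
open import Level using (Level; 0ℓ; _⊔_) renaming (suc to lsuc)
open import Relation.Binary.Bundles using (Setoid)
import Relation.Binary.Construct.On as On
open import Relation.Binary.PropositionalEquality using (_≡_; refl; sym; subst; _→-setoid_)
open import Relation.Binary.Structures using (IsPartialOrder)
open import Relation.Nullary using (¬_)
open import Relation.Unary using (Pred; _∈_; _∉_; _⊆_; _≐_; ∁; _∩_; U; ⋃; Empty; Satisfiable)

-- The theorem belongs to ordinary (ZFC) mathematics, where a set is a setoid.
-- In that reading the axiom of choice says that surjections of setoids have
-- congruent sections; excluded middle is taken from Axiom.ExcludedMiddle.

AxiomOfChoice : ∀ a ℓ → Set (lsuc (a ⊔ ℓ))
AxiomOfChoice a ℓ = {A B : Setoid a ℓ} (p : Surjection A B) →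
  Σ[ s ∈ Func B A ] (∀ b → Setoid._≈_ B (Surjection.to p (Func.to s b)) b)

-- x ∈ [0,∞] is represented by the set { q ∈ ℚ | x < q }: the empty set is ∞,
-- and the set of all positive rationals is 0.

record [0,∞] : Set₁ where
  field
    Upper    : Pred ℚ 0ℓ
    positive : ∀ {q} → q ∈ Upper → 0ℚ ℚ.< q
    upward   : ∀ {p q} → p ∈ Upper → p ℚ.≤ q → q ∈ Upper
    rounded  : ∀ {q} → q ∈ Upper → ∃[ p ] (p ∈ Upper × p ℚ.< q)

open [0,∞] public

infix 4 _≤_ _<_ _≈_
infixl 6 _+_ _⊔∞_ _⊓∞_

_≤_ _<_ _≈_ : [0,∞] → [0,∞] → Set
x ≤ y = Upper y ⊆ Upper x
x < y = ∃[ q ] (q ∈ Upper x × q ∉ Upper y)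
x ≈ y = x ≤ y × y ≤ x

Finite : [0,∞] → Set
Finite x = Satisfiable (Upper x)

0∞ : [0,∞]
0∞ = record
  { Upper    = 0ℚ ℚ.<_
  ; positive = λ 0<q → 0<q
  ; upward   = ℚ.<-≤-trans
  ; rounded  = λ 0<q → ℚ.<-dense 0<q
  }

∞ : [0,∞]
∞ = record
  { Upper    = λ _ → ⊥
  ; positive = λ ()
  ; upward   = λ ()
  ; rounded  = λ ()
  }

0<∞ : 0∞ < ∞
0<∞ = 1ℚ , ℚ.positive⁻¹ 1ℚ , λ ()

_+_ : [0,∞] → [0,∞] → [0,∞]
x + y = record
  { Upper    = λ q → ∃[ r ] ∃[ s ] (r ∈ Upper x × s ∈ Upper y × r ℚ.+ s ℚ.≤ q)
  ; positive = λ { (r , s , x<r , y<s , r+s≤q) →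
      ℚ.<-≤-trans (ℚ.+-mono-< (positive x x<r) (positive y y<s)) r+s≤q }
  ; upward   = λ { (r , s , x<r , y<s , r+s≤p) p≤q →
      r , s , x<r , y<s , ℚ.≤-trans r+s≤p p≤q }
  ; rounded  = λ { (r , s , x<r , y<s , r+s≤q) → let (r′ , x<r′ , r′<r) = rounded x x<r in
      r′ ℚ.+ s , (r′ , s , x<r′ , y<s , ℚ.≤-refl) , ℚ.<-≤-trans (ℚ.+-monoˡ-< s r′<r) r+s≤q }
  }

_⊔∞_ : [0,∞] → [0,∞] → [0,∞]
x ⊔∞ y = record
  { Upper    = Upper x ∩ Upper y
  ; positive = λ { (x<q , _) → positive x x<q }
  ; upward   = λ { (x<p , y<p) p≤q → upward x x<p p≤q , upward y y<p p≤q }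
  ; rounded  = λ { {q} (x<q , y<q) →
      let (r , x<r , r<q) = rounded x x<q
          (s , y<s , s<q) = rounded y y<q
      in r ℚ.⊔ s , (upward x x<r (ℚ.p≤p⊔q r s) , upward y y<s (ℚ.p≤q⊔p r s)) ,
         ⊔-< {r} {s} r<q s<q }
  }
  where
  ⊔-< : ∀ {r s q} → r ℚ.< q → s ℚ.< q → r ℚ.⊔ s ℚ.< q
  ⊔-< {r} {s} {q} r<q s<q with ℚ.⊔-sel r s
  ... | inj₁ e = subst (ℚ._< q) (sym e) r<q
  ... | inj₂ e = subst (ℚ._< q) (sym e) s<q

_⊓∞_ : [0,∞] → [0,∞] → [0,∞]
x ⊓∞ y = record
  { Upper    = λ q → q ∈ Upper x ⊎ q ∈ Upper y
  ; positive = λ { (inj₁ x<q) → positive x x<q ; (inj₂ y<q) → positive y y<q }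
  ; upward   = λ { (inj₁ x<p) p≤q → inj₁ (upward x x<p p≤q)
                 ; (inj₂ y<p) p≤q → inj₂ (upward y y<p p≤q) }
  ; rounded  = λ { (inj₁ x<q) → let (r , x<r , r<q) = rounded x x<q in r , inj₁ x<r , r<q
                 ; (inj₂ y<q) → let (r , y<r , r<q) = rounded y y<q in r , inj₂ y<r , r<q }
  }

≤-isPartialOrder : IsPartialOrder _≈_ _≤_
≤-isPartialOrder = record
  { isPreorder = record
    { isEquivalence = record
      { refl  = (λ q∈ → q∈) , (λ q∈ → q∈)
      ; sym   = λ { (x≤y , y≤x) → y≤x , x≤y }
      ; trans = λ { (x≤y , y≤x) (y≤z , z≤y) → (λ q∈ → x≤y (y≤z q∈)) , (λ q∈ → z≤y (y≤x q∈)) }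
      }
    ; reflexive = proj₁
    ; trans     = λ x≤y y≤z q∈ → x≤y (y≤z q∈)
    }
  ; antisym = _,_
  }

0≤ : ∀ x → 0∞ ≤ x
0≤ x = positive x

<-≤-trans : ∀ {x y z} → x < y → y ≤ z → x < z
<-≤-trans (q , x<q , y≮q) y≤z = q , x<q , λ z<q → y≮q (y≤z z<q)

≤-<-trans : ∀ {x y z} → x ≤ y → y < z → x < z
≤-<-trans x≤y (q , y<q , z≮q) = q , x≤y y<q , z≮q

0<⊓∞ : ∀ x y → 0∞ < x → 0∞ < y → 0∞ < x ⊓∞ y
0<⊓∞ x y (p , 0<p , x≮p) (q , 0<q , y≮q) with ℚ.⊓-sel p q
... | inj₁ e = p , 0<p , λ { (inj₁ x<p) → x≮p x<p
                           ; (inj₂ y<p) → y≮q (upward y y<p (subst (ℚ._≤ q) e (ℚ.p⊓q≤q p q))) }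
... | inj₂ e = q , 0<q , λ { (inj₁ x<q) → x≮p (upward x x<q (subst (ℚ._≤ p) e (ℚ.p⊓q≤p p q)))
                           ; (inj₂ y<q) → y≮q y<q }

maximum : ∀ {n} → (Fin n → [0,∞]) → [0,∞]
maximum = foldr _⊔∞_ 0∞

maximum⁺ : ∀ {n} (x : Fin n → [0,∞]) {q} → 0ℚ ℚ.< q →
           (∀ i → q ∈ Upper (x i)) → q ∈ Upper (maximum x)
maximum⁺ {zero}  x 0<q x<q = 0<q
maximum⁺ {suc n} x 0<q x<q = x<q zero , maximum⁺ (λ i → x (suc i)) 0<q (λ i → x<q (suc i))

maximum⁻ : ∀ {n} (x : Fin n → [0,∞]) {q} → q ∈ Upper (maximum x) → ∀ i → q ∈ Upper (x i)
maximum⁻ {suc n} x (x₀<q , _)   zero    = x₀<q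
maximum⁻ {suc n} x (_ , xs<q) (suc i) = maximum⁻ (λ j → x (suc j)) xs<q i

maximum-finite : ∀ {n} (x : Fin n → [0,∞]) → (∀ i → Finite (x i)) → Finite (maximum x)
maximum-finite {zero}  x fin = 1ℚ , ℚ.positive⁻¹ 1ℚ
maximum-finite {suc n} x fin =
  let (p , x₀<p) = fin zero
      (q , xs<q) = maximum-finite (λ i → x (suc i)) (λ i → fin (suc i))
  in p ℚ.⊔ q , upward (x zero) x₀<p (ℚ.p≤p⊔q p q) ,
               upward (maximum (λ i → x (suc i))) xs<q (ℚ.p≤q⊔p p q)

-- Under excluded middle every subset is, up to _≐_, a predicate at level 0.
-- Carriers at level 0 suffice for Polish spaces, which have at most 2^ℵ₀
-- points.

record Topology (S : Setoid 0ℓ 0ℓ) : Set₂ where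
  open Setoid S using (Carrier) renaming (_≈_ to _≈ₛ_)
  field
    Open     : Pred Carrier 0ℓ → Set₁
    Open-≐   : ∀ {V W} → V ≐ W → Open V → Open W
    Open-≈   : ∀ {V} → Open V → ∀ {x y} → x ≈ₛ y → x ∈ V → y ∈ V
    Open-U   : Open U
    Open-∩   : ∀ {V W} → Open V → Open W → Open (V ∩ W)
    Open-⋃   : ∀ {I : Set} {V : I → Pred Carrier 0ℓ} → (∀ i → Open (V i)) → Open (⋃ I V)

  Closed : Pred Carrier 0ℓ → Set₁
  Closed A = Open (∁ A)

  Closure : ∀ {a} → Pred Carrier a → Pred Carrier (lsuc 0ℓ ⊔ a)
  Closure A x = ∀ V → Open V → x ∈ V → Satisfiable (V ∩ A)

  NowhereDense : ∀ {a} → Pred Carrier a → Set (lsuc 0ℓ ⊔ a)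
  NowhereDense A = ∀ V → Open V → V ⊆ Closure A → Empty V

  Meagre : ∀ {a} → Pred Carrier a → Set (lsuc 0ℓ ⊔ a)
  Meagre A = Σ[ N ∈ (ℕ → Pred Carrier 0ℓ) ] ((∀ k → NowhereDense (N k)) × A ⊆ ⋃ ℕ N)

  CoMeagre : ∀ {a} → Pred Carrier a → Set (lsuc 0ℓ ⊔ a)
  CoMeagre A = Meagre (∁ A)

  Separable : Set₁
  Separable = Σ[ s ∈ (ℕ → Carrier) ] (∀ V → Open V → Satisfiable V → ∃[ k ] s k ∈ V)

  LowerSemicontinuous : (Carrier → [0,∞]) → Set₁
  LowerSemicontinuous f = ∀ r → Closed (λ x → f x ≤ r)

  UpperSemicontinuous : (Carrier → [0,∞]) → Set₁
  UpperSemicontinuous f = ∀ r → Open (λ x → f x < r)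

-- The order topology of [0,∞], generated by the open rays; for f into [0,∞],
-- continuity below refers to this topology.

data Ray : Set₁ where
  below above : [0,∞] → Ray

infix 4 _∈ᴿ_
_∈ᴿ_ : [0,∞] → Ray → Set
x ∈ᴿ below r = x < r
x ∈ᴿ above r = r < x

Open[0,∞] : Pred [0,∞] 0ℓ → Set₁
Open[0,∞] V = ∀ {x} → x ∈ V →
  Σ[ rays ∈ List Ray ] (All (x ∈ᴿ_) rays × (∀ {y} → All (y ∈ᴿ_) rays → y ∈ V))

module _ {S : Setoid 0ℓ 0ℓ} (τ : Topology S) where
  open Setoid S using (Carrier)
  open Topology

  Continuous[0,∞] : (Carrier → [0,∞]) → Set₁
  Continuous[0,∞] f = ∀ V → Open[0,∞] V → Open τ (λ x → f x ∈ V)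

  Continuous : {S′ : Setoid 0ℓ 0ℓ} → Topology S′ → (Carrier → Setoid.Carrier S′) → Set₁
  Continuous τ′ f = ∀ V → Open τ′ V → Open τ (λ x → f x ∈ V)

  infixr 2 _⊗_
  _⊗_ : {S′ : Setoid 0ℓ 0ℓ} → Topology S′ → Topology (×-setoid S S′)
  _⊗_ {S′} τ′ = record
    { Open   = λ W → ∀ {x y} → (x , y) ∈ W →
        Σ[ V ∈ Pred Carrier 0ℓ ] Σ[ V′ ∈ Pred (Setoid.Carrier S′) 0ℓ ]
          (Open τ V × Open τ′ V′ × x ∈ V × y ∈ V′ ×
           (∀ {x′ y′} → x′ ∈ V → y′ ∈ V′ → (x′ , y′) ∈ W))
    ; Open-≐ = λ { (V⊆W , W⊆V) oV w →
        let (A , B , oA , oB , a , b , sub) = oV (W⊆V w)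
        in A , B , oA , oB , a , b , λ a′ b′ → V⊆W (sub a′ b′) }
    ; Open-≈ = λ { oV (x≈ , y≈) v →
        let (A , B , oA , oB , a , b , sub) = oV v
        in sub (Open-≈ τ oA x≈ a) (Open-≈ τ′ oB y≈ b) }
    ; Open-U = λ _ → U , U , Open-U τ , Open-U τ′ , _ , _ , λ _ _ → _
    ; Open-∩ = λ { oV oW (v , w) →
        let (A , B , oA , oB , a , b , sub) = oV v
            (C , D , oC , oD , c , d , sub′) = oW w
        in A ∩ C , B ∩ D , Open-∩ τ oA oC , Open-∩ τ′ oB oD , (a , c) , (b , d) ,
           λ { (a′ , c′) (b′ , d′) → sub a′ b′ , sub′ c′ d′ } }
    ; Open-⋃ = λ { oV (i , v) →
        let (A , B , oA , oB , a , b , sub) = oV i v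
        in A , B , oA , oB , a , b , λ a′ b′ → i , sub a′ b′ }
    }

  power : ∀ n → Topology (VecEq.≋-setoid S n)
  power n = record
    { Open   = λ W → ∀ {x} → x ∈ W →
        Σ[ V ∈ (Fin n → Pred Carrier 0ℓ) ]
          ((∀ i → Open τ (V i)) × (∀ i → x i ∈ V i) × (∀ {y} → (∀ i → y i ∈ V i) → y ∈ W))
    ; Open-≐ = λ { (V⊆W , W⊆V) oV w →
        let (A , oA , a , sub) = oV (W⊆V w) in A , oA , a , λ y∈ → V⊆W (sub y∈) }
    ; Open-≈ = λ oV x≈y v →
        let (A , oA , a , sub) = oV v in sub (λ i → Open-≈ τ (oA i) (x≈y i) (a i))
    ; Open-U = λ _ → (λ _ → U) , (λ _ → Open-U τ) , _ , λ _ → _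
    ; Open-∩ = λ { oV oW (v , w) →
        let (A , oA , a , sub)  = oV v
            (B , oB , b , sub′) = oW w
        in (λ i → A i ∩ B i) , (λ i → Open-∩ τ (oA i) (oB i)) , (λ i → a i , b i) ,
           λ y∈ → sub (λ i → proj₁ (y∈ i)) , sub′ (λ i → proj₂ (y∈ i)) }
    ; Open-⋃ = λ { oV (i , v) →
        let (A , oA , a , sub) = oV i v in A , oA , a , λ y∈ → i , sub y∈ }
    }

-- Only graded subgroups may take the value ∞, not metrics: hence the field finite.

record Metric (S : Setoid 0ℓ 0ℓ) : Set₁ where
  open Setoid S using (Carrier) renaming (_≈_ to _≈ₛ_)
  field
    dist            : Carrier → Carrier → [0,∞]
    isGeneralMetric : IsGeneralMetric _≈ₛ_ _≈_ _≤_ 0∞ _+_ dist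
    finite          : ∀ x y → Finite (dist x y)

  open IsGeneralMetric isGeneralMetric public using (cong; ≈⇒0; 0⇒≈; sym; triangle)

  Ball : Carrier → [0,∞] → Pred Carrier 0ℓ
  Ball x r y = dist x y < r

  topology : Topology S
  topology = record
    { Open   = λ V → ∀ {x} → x ∈ V → ∃[ r ] (0∞ < r × Ball x r ⊆ V)
    ; Open-≐ = λ { (V⊆W , W⊆V) oV w →
        let (r , 0<r , sub) = oV (W⊆V w) in r , 0<r , λ y∈ → V⊆W (sub y∈) }
    ; Open-≈ = λ oV {x} {y} x≈y v →
        let (r , 0<r , sub) = oV v
        in sub (≤-<-trans {dist x y} {0∞} {r} (proj₁ (≈⇒0 x≈y)) 0<r)
    ; Open-U = λ _ → ∞ , 0<∞ , λ _ → _
    ; Open-∩ = λ { oV oW {x} (v , w) →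
        let (r , 0<r , sub)  = oV v
            (s , 0<s , sub′) = oW w
        in r ⊓∞ s , 0<⊓∞ r s 0<r 0<s ,
           λ {y} y∈ → sub  (<-≤-trans {dist x y} {r ⊓∞ s} {r} y∈ inj₁) ,
                      sub′ (<-≤-trans {dist x y} {r ⊓∞ s} {s} y∈ inj₂) }
    ; Open-⋃ = λ { oV (i , v) →
        let (r , 0<r , sub) = oV i v in r , 0<r , λ y∈ → i , sub y∈ }
    }

  Cauchy : (ℕ → Carrier) → Set₁
  Cauchy s = ∀ r → 0∞ < r → ∃[ N ] (∀ m n → N ≤ℕ m → N ≤ℕ n → dist (s m) (s n) < r)

  infix 4 _ConvergesTo_
  _ConvergesTo_ : (ℕ → Carrier) → Carrier → Set₁
  s ConvergesTo x = ∀ r → 0∞ < r → ∃[ N ] (∀ n → N ≤ℕ n → dist (s n) x < r)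

  Complete : Set₁
  Complete = ∀ s → Cauchy s → ∃[ x ] (s ConvergesTo x)

open Metric using (dist; topology; Complete)

maxMetric : ∀ {S} → Metric S → ∀ n → Metric (VecEq.≋-setoid S n)
maxMetric {S} ∂ n = record
  { dist            = δ
  ; isGeneralMetric = record
    { isSemiMetric = record
      { isQuasiSemiMetric = record
        { isPreMetric = record
          { isProtoMetric = record
            { isPartialOrder  = ≤-isPartialOrder
            ; ≈-isEquivalence = VecEq.≋-isEquivalence S n
            ; cong            = λ x≈x′ y≈y′ →
                mono (λ i → proj₁ (M.cong (x≈x′ i) (y≈y′ i))) ,
                mono (λ i → proj₂ (M.cong (x≈x′ i) (y≈y′ i)))
            ; nonNegative     = λ {x} {y} → 0≤ (δ x y)
            }
          ; ≈⇒0 = λ {x} {y} x≈y →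
              (λ 0<q → maximum⁺ _ 0<q (λ i → proj₁ (M.≈⇒0 (x≈y i)) 0<q)) , 0≤ (δ x y)
          }
        ; 0⇒≈ = λ {x} {y} δ≈0 i →
            M.0⇒≈ ((λ 0<q → maximum⁻ _ (proj₁ δ≈0 0<q) i) , 0≤ (dist ∂ (x i) (y i)))
        }
      ; sym = λ x y → mono (λ i → proj₁ (M.sym (x i) (y i))) ,
                      mono (λ i → proj₂ (M.sym (x i) (y i)))
      }
    ; triangle = λ { x y z δ+δ<q@(r , s , xy<r , yz<s , r+s≤q) →
        maximum⁺ _ (positive (δ x y + δ y z) δ+δ<q) (λ i →
          M.triangle (x i) (y i) (z i)
            (r , s , maximum⁻ _ xy<r i , maximum⁻ _ yz<s i , r+s≤q)) }
    }
  ; finite          = λ x y → maximum-finite _ (λ i → M.finite (x i) (y i))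
  }
  where
  module M = Metric ∂
  δ : (x y : Fin n → Setoid.Carrier S) → [0,∞]
  δ x y = maximum (λ i → dist ∂ (x i) (y i))
  mono : {x y : Fin n → [0,∞]} → (∀ i → x i ≤ y i) → maximum x ≤ maximum y
  mono {x} {y} x≤y y<q =
    maximum⁺ x (positive (maximum y) y<q) (λ i → x≤y i (maximum⁻ y y<q i))

record IsPolish {S : Setoid 0ℓ 0ℓ} (τ : Topology S) : Set₁ where
  open Topology
  field
    metric     : Metric S
    compatible : ∀ V → (Open τ V → Open (topology metric) V) × (Open (topology metric) V → Open τ V)
    complete   : Complete metric
    separable  : Separable τ

record IsPolishGroup (G : Group 0ℓ 0ℓ) (τ : Topology (Group.setoid G)) : Set₁ where
  open Group G using (_∙_; _⁻¹)
  field
    isPolish      : IsPolish τ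
    ∙-continuous  : Continuous (τ ⊗ τ) τ (uncurry _∙_)
    ⁻¹-continuous : Continuous τ τ _⁻¹

record PolishTopometricGroup : Set₂ where
  field
    group : Group 0ℓ 0ℓ
  open Group group public using (Carrier; _∙_; ε; _⁻¹; setoid)
  field
    τ             : Topology setoid
    isPolishGroup : IsPolishGroup group τ
    ∂             : Metric setoid
    ∂-complete    : Complete ∂
    ∂-invariantˡ  : ∀ k g h → dist ∂ (k ∙ g) (k ∙ h) ≈ dist ∂ g h
    ∂-invariantʳ  : ∀ k g h → dist ∂ (g ∙ k) (h ∙ k) ≈ dist ∂ g h
    ∂-refines-τ   : ∀ V → Topology.Open τ V → Topology.Open (topology ∂) V
    ∂-lsc         : Topology.LowerSemicontinuous (τ ⊗ τ) (uncurry (dist ∂))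

module _ (𝔾 : PolishTopometricGroup) where
  open PolishTopometricGroup 𝔾

  DiagonalConjugates : ∀ {n} → (Fin n → Carrier) → Pred (Fin n → Carrier) 0ℓ
  DiagonalConjugates g h = ∃[ k ] VecEq._≋_ setoid h (λ i → k ∙ g i ∙ k ⁻¹)

  AmpleGenerics : Set₁
  AmpleGenerics = ∀ n → Σ[ g ∈ (Fin n → Carrier) ]
    Topology.CoMeagre (power τ n)
      (Topology.Closure (topology (maxMetric ∂ n)) (DiagonalConjugates g))

record GradedSubgroup (G : Group 0ℓ 0ℓ) : Set₁ where
  open Group G using (Carrier; _∙_; ε; _⁻¹) renaming (_≈_ to _≈ᴳ_)
  field
    H      : Carrier → [0,∞]
    H-cong : ∀ {g h} → g ≈ᴳ h → H g ≈ H h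
    H-ε    : H ε ≈ 0∞
    H-⁻¹   : ∀ g → H g ≈ H (g ⁻¹)
    H-∙    : ∀ h g → H (h ∙ g) ≤ H h + H g

  d : Carrier → Carrier → [0,∞]
  d g h = H (g ⁻¹ ∙ h)

  Dense : Pred Carrier 0ℓ → Set₁
  Dense D = ∀ g r → 0∞ < r → ∃[ h ] (h ∈ D × d g h < r)

infix 4 _≺_
_≺_ : Setoid 0ℓ 0ℓ → Setoid 0ℓ 0ℓ → Set
A ≺ B = Injection A B × ¬ Injection B A

2^ℵ₀ : Setoid 0ℓ 0ℓ
2^ℵ₀ = ℕ →-setoid Bool

subset : (S : Setoid 0ℓ 0ℓ) → Pred (Setoid.Carrier S) 0ℓ → Setoid 0ℓ 0ℓ
subset S D = On.setoid S (proj₁ {B = D})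

-- The index is the least cardinality of a d-dense subset, so it is less than
-- κ exactly when some d-dense subset has cardinality less than κ.

IndexLessThan : {G : Group 0ℓ 0ℓ} → Setoid 0ℓ 0ℓ → GradedSubgroup G → Set₁
IndexLessThan {G} κ 𝓗 = ∃[ D ] (GradedSubgroup.Dense 𝓗 D × subset (Group.setoid G) D ≺ κ)

SmallDensityProperty : PolishTopometricGroup → Set₁
SmallDensityProperty 𝔾 = (𝓗 : GradedSubgroup group) →
  Topology.LowerSemicontinuous (topology ∂) (GradedSubgroup.H 𝓗) →
  IndexLessThan 2^ℵ₀ 𝓗 →
  Topology.UpperSemicontinuous τ (GradedSubgroup.H 𝓗) ×
  Continuous[0,∞] τ (GradedSubgroup.H 𝓗)
  where open PolishTopometricGroup 𝔾

{-# OPTIONS --safe #-}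
module Submission where

-- Index < 2^ℵ₀ rules out a Cantor scheme whose branches h satisfy H (h⁻¹h′) ≥ u for h ≠ h′, as distinct
-- branches would need distinct points of any d-dense set. Such a scheme exists if some {H < u} is meagre
-- (Mycielski). Otherwise suppose that {H < t} is no neighbourhood of 1. By Pettis' argument {H ≥ t/2} is
-- non-meagre in every non-empty open set, and by ∂-lower semicontinuity so is, throughout some open V, a
-- set of points on whose ∂-balls of a fixed radius H ≥ 3u, while A = {H < u} is non-meagre throughout V.
-- Ample generics provide, for a generic tuple x, points y of A and z of the other set together with w
-- close to 1 such that conjugation by w moves (x,z) to (x,y) up to a small ∂-distance: the set of points
-- reached by conjugators from a small ball is analytic, hence has the Baire property, so that a piece
-- containing y has plenty of points of the other set. Iterating along the binary tree, the limits of
-- branches separating at such a step satisfy h y h⁻¹ ≈ h′ z h′⁻¹, which forces H (h⁻¹h′) ≥ u.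
open import Defs
open import Axiom.ExcludedMiddle using (ExcludedMiddle)

open import Algebra.Bundles using (Group)
import Algebra.Properties.Group
open import Data.Bool.Base using (Bool; true; false)
import Data.Bool.Properties as Bool
open import Data.Empty using (⊥; ⊥-elim)
open import Data.Fin.Base using (Fin; zero; suc)
open import Data.Integer.Base as ℤ using (+_; -[1+_])
import Data.Integer.Properties as ℤ
import Data.Integer.Tactic.RingSolver as ℤ-Solver
open import Data.List.Base using (List; []; _∷_; length; map; _++_; upTo; cartesianProduct)
import Data.List.Properties as List
open import Data.List.Membership.Propositional using () renaming (_∈_ to _∈ₗ_)
open import Data.List.Membership.Propositional.Properties
  using (∈-map⁺; ∈-++⁺ˡ; ∈-++⁺ʳ; ∈-upTo⁺; ∈-cartesianProduct⁺)
open import Data.List.Relation.Unary.All as All using (All; []; _∷_)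
open import Data.List.Relation.Unary.Any using (here)
open import Data.Nat.Base as ℕ using (ℕ; zero; suc)
import Data.Nat.Properties as ℕ
open import Data.Product.Base using (Σ-syntax; ∃-syntax; _×_; _,_; proj₁; proj₂; uncurry)
open import Data.Product.Relation.Binary.Pointwise.NonDependent using (×-setoid)
open import Data.Rational.Base as ℚ using (ℚ; 0ℚ; 1ℚ; ½; mkℚ)
import Data.Rational.Properties as ℚ
open import Data.Rational.Solver using (module +-*-Solver)
import Data.Rational.Unnormalised.Base as ℚᵘ
import Data.Rational.Unnormalised.Properties as ℚᵘ
open import Data.Sum.Base using (_⊎_; inj₁; inj₂)
import Data.Vec.Functional as Vec
open import Function.Bundles using (Func; Injection)
open import Level using (0ℓ)
open import Relation.Binary.Bundles using (Setoid)
import Relation.Binary.Construct.On as On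
open import Relation.Binary.PropositionalEquality as ≡ using (_≡_; _≢_; refl; subst)
open import Relation.Nullary using (¬_; yes; no)
open import Relation.Nullary.Decidable using (True; toWitness; fromWitness; decidable-stable)
open import Relation.Unary using (Pred; _∈_; _∉_; _⊆_; _∩_; U)

-- Halving and Archimedean estimates for rationals.

opaque
  halve : ∀ {q} → 0ℚ ℚ.< q → ∃[ p ] (0ℚ ℚ.< p × p ℚ.+ p ℚ.≤ q)
  halve {q} 0<q = ½ ℚ.* q ,
    subst (ℚ._< ½ ℚ.* q) (ℚ.*-zeroʳ ½) (ℚ.*-monoʳ-<-pos ½ 0<q) ,
    ℚ.≤-reflexive (≡.trans (≡.sym (ℚ.*-distribʳ-+ q ½ ½)) (ℚ.*-identityˡ q))

  slack : ∀ {p q} → p ℚ.< q → ∃[ δ ] (0ℚ ℚ.< δ × p ℚ.+ δ ≡ q)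
  slack {p} {q} p<q = q ℚ.- p ,
    subst (ℚ._< q ℚ.- p) (ℚ.+-inverseʳ p) (ℚ.+-monoˡ-< (ℚ.- p) p<q) ,
    solve 2 (λ p q → p :+ (q :- p) := q) refl p q
    where open +-*-Solver

infixr 8 _⊠_
_⊠_ : ℕ → ℚ → ℚ
zero  ⊠ q = 0ℚ
suc n ⊠ q = q ℚ.+ n ⊠ q

toℚᵘ-⊠ : ∀ n p → ℚ.toℚᵘ (n ⊠ p) ℚᵘ.≃ ℚᵘ.mkℚᵘ (+ n ℤ.* ℚ.↥ p) (ℚ.denominator-1 p)
toℚᵘ-⊠ zero    _          = ℚᵘ.*≡* refl
toℚᵘ-⊠ (suc n) p@record{} = ℚᵘ.≃-trans (ℚ.toℚᵘ-homo-+ p (n ⊠ p)) (ℚᵘ.≃-trans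
  (ℚᵘ.+-congʳ (ℚ.toℚᵘ p) (toℚᵘ-⊠ n p)) (ℚᵘ.*≡* (lemma (+ n) (ℚ.↥ p) (ℚ.↧ p))))
  where
  lemma : ∀ n a d → (a ℤ.* d ℤ.+ n ℤ.* a ℤ.* d) ℤ.* d ≡ (+ 1 ℤ.+ n) ℤ.* a ℤ.* (d ℤ.* d)
  lemma = ℤ-Solver.solve-∀

archimedean : ∀ {p} → 0ℚ ℚ.< p → ∀ q → ∃[ n ] q ℚ.≤ n ⊠ p
archimedean {mkℚ -[1+ _ ] _ _} (ℚ.*<* ())
archimedean {mkℚ (+ zero) _ _} (ℚ.*<* (ℤ.+<+ ()))
archimedean {p@(mkℚ (+ suc a) d _)} 0<p q@record{} = n , ℚ.toℚᵘ-cancel-≤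
  (ℚᵘ.≤-respʳ-≃ (ℚᵘ.≃-sym (toℚᵘ-⊠ n p)) (ℚᵘ.*≤* bound))
  where
  -- `p` is at least the reciprocal of its denominator, so this many copies of `p` reach the
  -- absolute value of the numerator of `q`, and that bounds `q`.
  n = ℤ.∣ ℚ.↥ q ∣ ℕ.* suc d
  open ℤ.≤-Reasoning
  i≤∣i∣ : ∀ i → i ℤ.≤ + ℤ.∣ i ∣
  i≤∣i∣ (+ n)    = ℤ.≤-refl
  i≤∣i∣ -[1+ n ] = ℤ.-≤+
  bound : ℚ.↥ q ℤ.* + suc d ℤ.≤ + n ℤ.* + suc a ℤ.* ℚ.↧ q
  bound = begin
    ℚ.↥ q ℤ.* + suc d                   ≤⟨ ℤ.*-monoʳ-≤-nonNeg (+ suc d) (i≤∣i∣ (ℚ.↥ q)) ⟩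
    + ℤ.∣ ℚ.↥ q ∣ ℤ.* + suc d           ≡⟨ ℤ.pos-* ℤ.∣ ℚ.↥ q ∣ (suc d) ⟨
    + n                                 ≤⟨ ℤ.+≤+ (ℕ.m≤m*n n (suc a)) ⟩
    + (n ℕ.* suc a)                     ≤⟨ ℤ.+≤+ (ℕ.m≤m*n (n ℕ.* suc a) (suc (ℚ.denominator-1 q))) ⟩
    + (n ℕ.* suc a ℕ.* suc (ℚ.denominator-1 q)) ≡⟨ ℤ.pos-* (n ℕ.* suc a) _ ⟩
    + (n ℕ.* suc a) ℤ.* ℚ.↧ q           ≡⟨ ≡.cong (ℤ._* ℚ.↧ q) (ℤ.pos-* n (suc a)) ⟩
    + n ℤ.* + suc a ℤ.* ℚ.↧ q ∎

p≤q+p : ∀ {p q} → 0ℚ ℚ.< q → p ℚ.≤ q ℚ.+ p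
p≤q+p {p} 0<q = ℚ.≤-trans (ℚ.≤-reflexive (≡.sym (ℚ.+-identityˡ p))) (ℚ.+-monoˡ-≤ p (ℚ.<⇒≤ 0<q))

p<p+p : ∀ {p} → 0ℚ ℚ.< p → p ℚ.< p ℚ.+ p
p<p+p {p} 0<p = subst (ℚ._< p ℚ.+ p) (ℚ.+-identityʳ p) (ℚ.+-monoʳ-< p 0<p)

-- k+1 halvings reduce a bound (k+2)ε to ε because (k+2)/2 ≤ k+1.
opaque
  halving⇒small : (q : ℕ → ℚ) → (∀ n → q (suc n) ℚ.+ q (suc n) ℚ.≤ q n) →
                  ∀ {ε} → 0ℚ ℚ.< ε → ∃[ n ] q n ℚ.≤ ε
  halving⇒small q half {ε} 0<ε = go (proj₁ (archimedean 0<ε (q 0))) 0 (proj₂ (archimedean 0<ε (q 0)))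
    where
    ε≤ : ∀ k → ε ℚ.≤ suc k ⊠ ε
    ε≤ zero = ℚ.≤-reflexive (≡.sym (ℚ.+-identityʳ ε))
    ε≤ (suc k) = ℚ.≤-trans (ε≤ k) (p≤q+p 0<ε)
    cancel : ∀ {a b} → a ℚ.+ a ℚ.≤ b ℚ.+ b → a ℚ.≤ b
    cancel {a} {b} a+a≤b+b = ℚ.≮⇒≥ λ b<a → ℚ.<-irrefl refl (ℚ.<-≤-trans (ℚ.+-mono-< b<a b<a) a+a≤b+b)
    go : ∀ k n → q n ℚ.≤ k ⊠ ε → ∃[ n ] q n ℚ.≤ ε
    go zero n q≤ = n , ℚ.≤-trans q≤ (ℚ.<⇒≤ 0<ε)
    go (suc zero) n q≤ = n , ℚ.≤-trans q≤ (ℚ.≤-reflexive (ℚ.+-identityʳ ε))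
    go (suc (suc k)) n q≤ = go (suc k) (suc n) (cancel (ℚ.≤-trans (half n)
      (ℚ.≤-trans q≤ (ℚ.+-monoˡ-≤ (suc k ⊠ ε) (ε≤ k)))))

0<⊓ : ∀ p q → 0ℚ ℚ.< p → 0ℚ ℚ.< q → 0ℚ ℚ.< p ℚ.⊓ q
0<⊓ p q 0<p 0<q with ℚ.⊓-sel p q
... | inj₁ e = subst (0ℚ ℚ.<_) (≡.sym e) 0<p
... | inj₂ e = subst (0ℚ ℚ.<_) (≡.sym e) 0<q

-- Embeds the positive rationals into [0,∞], supplying the radii and thresholds that the topological
-- definitions ask for.
cut : ∀ q → 0ℚ ℚ.< q → [0,∞]
cut q 0<q = record
  { Upper    = q ℚ.<_
  ; positive = ℚ.<-trans 0<q
  ; upward   = ℚ.<-≤-trans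
  ; rounded  = ℚ.<-dense
  }

0<cut : ∀ {q} (0<q : 0ℚ ℚ.< q) → 0∞ < cut q 0<q
0<cut {q} 0<q = q , 0<q , ℚ.<-irrefl refl

<cut : ∀ x {q} (0<q : 0ℚ ℚ.< q) → x < cut q 0<q → q ∈ Upper x
<cut x 0<q (p , x<p , q≮p) = upward x x<p (ℚ.≮⇒≥ q≮p)

-- An enumeration of pairs of natural numbers.

unpair : ℕ → ℕ × ℕ
unpair zero    = 0 , 0
unpair (suc n) with unpair n
... | a , zero  = 0 , suc a
... | a , suc b = suc a , b

opaque
  -- `unpair` runs along the antidiagonals, with (0 , j + 1) following (j , 0). The recursion walks
  -- back along this path, on the sum first and then on `k`.
  unpair-surjective : ∀ k j → ∃[ n ] unpair n ≡ (k , j)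
  unpair-surjective k j = go (k ℕ.+ j) k j refl
    where
    go : ∀ d k j → k ℕ.+ j ≡ d → ∃[ n ] unpair n ≡ (k , j)
    go zero    zero    zero    _ = 0 , refl
    go (suc d) zero    (suc j) e with go d j zero (≡.trans (ℕ.+-identityʳ j) (ℕ.suc-injective e))
    ... | n , eq = suc n , lemma
      where
      lemma : unpair (suc n) ≡ (0 , suc j)
      lemma rewrite eq = refl
    go d       (suc k) j       e with go d k (suc j) (≡.trans (ℕ.+-suc k j) e)
    ... | n , eq = suc n , lemma
      where
      lemma : unpair (suc n) ≡ (suc k , j)
      lemma rewrite eq = refl

-- Rational balls and shrinking sequences of balls.

module _ {S : Setoid 0ℓ 0ℓ} (μ : Metric S) where
  open Setoid S using (Carrier)
  open Metric μ

  B : Carrier → ℚ → Pred Carrier 0ℓ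
  B c q x = q ∈ Upper (dist c x)

  B-refl : ∀ c {q} → 0ℚ ℚ.< q → c ∈ B c q
  B-refl c = proj₁ (≈⇒0 (Setoid.refl S))

  B-sym : ∀ {c x q} → x ∈ B c q → c ∈ B x q
  B-sym {c} {x} = proj₁ (Metric.sym μ x c)

  B-triangle : ∀ {x y z p q} → y ∈ B x p → z ∈ B y q → z ∈ B x (p ℚ.+ q)
  B-triangle {x} {y} {z} {p} {q} xy yz = triangle x y z (p , q , xy , yz , ℚ.≤-refl)

  B-mono : ∀ {c p q} → p ℚ.≤ q → B c p ⊆ B c q
  B-mono {c} p≤q {x} x∈ = upward (dist c x) x∈ p≤q

  B-pos : ∀ {c x q} → x ∈ B c q → 0ℚ ℚ.< q
  B-pos {c} {x} = positive (dist c x)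

  open⇒ball : ∀ {V} → Topology.Open topology V → ∀ {x} → x ∈ V → ∃[ q ] (0ℚ ℚ.< q × B x q ⊆ V)
  open⇒ball oV x∈V = let (r , (q , 0<q , r≮q) , sub) = oV x∈V in
    q , 0<q , λ y∈ → sub (q , y∈ , r≮q)

  balls⇒open : ∀ {V} → (∀ {x} → x ∈ V → ∃[ q ] (0ℚ ℚ.< q × B x q ⊆ V)) → Topology.Open topology V
  balls⇒open ball {x} x∈V = let (q , 0<q , sub) = ball x∈V in
    cut q 0<q , 0<cut 0<q , λ {y} y∈ → sub (<cut (dist x y) 0<q y∈)

  B-open : ∀ c q → Topology.Open topology (B c q)
  B-open c q = balls⇒open λ {x} x∈ →
    let (p , x∈p , p<q) = rounded (dist c x) x∈
        (δ , 0<δ , p+δ≡q) = slack p<q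
    in δ , 0<δ , λ y∈ → B-mono (ℚ.≤-reflexive p+δ≡q) (B-triangle x∈p y∈)

  -- Leaving room for twice the new radius serves two ends: radii at least halve, and the limit of
  -- the centres lies in every open ball, not merely in its closure.
  Shrinks : Carrier × ℚ → Carrier × ℚ → Set
  Shrinks (c , q) (c′ , q′) = ∃[ δ ] (c′ ∈ B c δ × δ ℚ.+ (q′ ℚ.+ q′) ℚ.≤ q)

  Shrinking : (ℕ → Carrier × ℚ) → Set
  Shrinking ball = ∀ n → Shrinks (ball n) (ball (suc n))

  shrinks⇒half : ∀ u v → Shrinks u v → proj₂ v ℚ.+ proj₂ v ℚ.≤ proj₂ u
  shrinks⇒half _ _ (δ , c′∈ , δ+2q′≤q) = ℚ.≤-trans (p≤q+p (B-pos c′∈)) δ+2q′≤q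

  opaque
    shrinking-absorbed : (ball : ℕ → Carrier × ℚ) → Shrinking ball →
      ∀ {x} → (∀ n → x ∈ uncurry B (ball n)) → ∀ {ε} → 0ℚ ℚ.< ε → ∃[ n ] uncurry B (ball n) ⊆ B x ε
    shrinking-absorbed ball shrinks x∈ 0<ε =
      let (δ , 0<δ , 2δ≤ε) = halve 0<ε
          (n , q≤δ) = halving⇒small (λ n → proj₂ (ball n))
                        (λ n → shrinks⇒half (ball n) (ball (suc n)) (shrinks n)) 0<δ
      in n , λ y∈ → B-mono (ℚ.≤-trans (ℚ.+-mono-≤ q≤δ q≤δ) 2δ≤ε) (B-triangle (B-sym (x∈ n)) y∈)

  shrinking-later : (ball : ℕ → Carrier × ℚ) → (∀ n → 0ℚ ℚ.< proj₂ (ball n)) → Shrinking ball →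
    ∀ {n m} → n ℕ.≤ m → proj₁ (ball m) ∈ uncurry B (ball n)
  shrinking-later ball 0<q shrinks {n} {m} n≤m =
    subst (λ m → proj₁ (ball m) ∈ uncurry B (ball n)) (ℕ.m∸n+n≡m n≤m) (later (m ℕ.∸ n) n)
    where
    later : ∀ k n → proj₁ (ball (k ℕ.+ n)) ∈ uncurry B (ball n)
    later zero    n = B-refl (proj₁ (ball n)) (0<q n)
    later (suc k) n = let (δ , c′∈ , δ+2q≤q) = shrinks n in
      subst (λ m → proj₁ (ball m) ∈ uncurry B (ball n)) (ℕ.+-suc k n)
        (B-mono (ℚ.≤-trans (ℚ.+-monoʳ-≤ δ (p≤q+p (0<q (suc n)))) δ+2q≤q)
          (B-triangle c′∈ (later k (suc n))))

  opaque
    shrinking-limit : Complete → (ball : ℕ → Carrier × ℚ) → (∀ n → 0ℚ ℚ.< proj₂ (ball n)) →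
      Shrinking ball → ∃[ x ] (∀ n → x ∈ uncurry B (ball n))
    shrinking-limit complete ball 0<q shrinks = x , x∈
      where
      c : ℕ → Carrier
      c n = proj₁ (ball n)

      q : ℕ → ℚ
      q n = proj₂ (ball n)

      later : ∀ {n m} → n ℕ.≤ m → c m ∈ B (c n) (q n)
      later = shrinking-later ball 0<q shrinks

      cauchy : Cauchy c
      cauchy r (p , 0<p , r≮p) =
        let (ε , 0<ε , 2ε≤p) = halve 0<p
            (n , q≤ε) = halving⇒small q (λ n → shrinks⇒half (ball n) (ball (suc n)) (shrinks n)) 0<ε
        in n , λ m m′ n≤m n≤m′ → p ,
          B-mono (ℚ.≤-trans (ℚ.+-mono-≤ q≤ε q≤ε) 2ε≤p) (B-triangle (B-sym (later n≤m)) (later n≤m′)) , r≮p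

      x : Carrier
      x = proj₁ (complete c cauchy)

      x∈ : ∀ n → x ∈ B (c n) (q n)
      x∈ n =
        let (δ , c′∈ , δ+2q≤q) = shrinks n
            0<q′ = 0<q (suc n)
            (N , close) = proj₂ (complete c cauchy) (cut (q (suc n)) 0<q′) (0<cut 0<q′)
            m = N ℕ.+ suc n
        -- One copy of `q (suc n)` reaches a late centre, the other leads from there to the limit.
        in B-mono δ+2q≤q (B-triangle c′∈ (B-triangle (later (ℕ.m≤n+m (suc n) N))
             (<cut (dist (c m) x) 0<q′ (close m (ℕ.m≤m+n N (suc n))))))

module _ (em : ∀ {ℓ} → ExcludedMiddle ℓ) where

  byContradiction : ∀ {ℓ} {P : Set ℓ} → ¬ ¬ P → P
  byContradiction = decidable-stable em

  ¬∀⇒∃¬ : ∀ {a p} {A : Set a} {P : A → Set p} → ¬ (∀ x → P x) → ∃[ x ] ¬ P x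
  ¬∀⇒∃¬ ¬∀ = byContradiction λ ¬∃ → ¬∀ λ x → byContradiction λ ¬Px → ¬∃ (x , ¬Px)

  -- Open sets are predicates at level 0, while meagreness lives higher; passing to the truth value
  -- of a decision brings it down.
  Resize : ∀ {ℓ} → Set ℓ → Set
  Resize P = True (em {P = P})

-- Baire category.

record OpenIn {S : Setoid 0ℓ 0ℓ} (τ : Topology S) (V : Pred (Setoid.Carrier S) 0ℓ) : Set₁ where
  field
    set       : Pred (Setoid.Carrier S) 0ℓ
    open′     : Topology.Open τ set
    point     : Setoid.Carrier S
    point∈    : point ∈ set
    ⊆V        : set ⊆ V

open OpenIn

whole : ∀ {S : Setoid 0ℓ 0ℓ} {τ : Topology S} {V} → Topology.Open τ V → ∀ {x} → x ∈ V → OpenIn τ V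
whole oV x∈V = record { open′ = oV ; point∈ = x∈V ; ⊆V = λ x∈ → x∈ }

IsBase : {S : Setoid 0ℓ 0ℓ} → Topology S → (ℕ → Pred (Setoid.Carrier S) 0ℓ) → Set₁
IsBase τ b = (∀ n → Open (b n)) × (∀ {V} → Open V → ∀ {x} → x ∈ V → ∃[ n ] (x ∈ b n × b n ⊆ V))
  where open Topology τ

module Category (em : ∀ {ℓ} → ExcludedMiddle ℓ) {S : Setoid 0ℓ 0ℓ} (τ : Topology S) where
  open Setoid S using (Carrier)
  open Topology τ

  OpenAvoiding : ∀ {a} → Pred Carrier a → Pred Carrier 0ℓ → Set _
  OpenAvoiding N V = Σ[ W ∈ OpenIn τ V ] (∀ {y} → y ∈ set W → y ∉ N)

  opaque
    -- If every non-empty open part of `V` met `N`, then `V` would lie in the closure of `N`.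
    nowhereDense⁻ : ∀ {a} {N : Pred Carrier a} → NowhereDense N →
      ∀ {V} → Open V → ∀ {x} → x ∈ V → OpenAvoiding N V
    nowhereDense⁻ {N = N} nd {V} oV {x} x∈V = byContradiction em λ none →
      nd V oV (λ {y} y∈V T oT y∈T → byContradiction em λ ¬sat → none
        (record { set = V ∩ T ; open′ = Open-∩ oV oT ; point = y ; point∈ = y∈V , y∈T ; ⊆V = proj₁ }
        , λ { {z} (_ , z∈T) z∈N → ¬sat (z , z∈T , z∈N) })) x x∈V

  nowhereDense⁺ : ∀ {a} {N : Pred Carrier a} →
    (∀ {V} → Open V → ∀ {x} → x ∈ V → OpenAvoiding N V) →
    NowhereDense N
  nowhereDense⁺ avoid V oV V⊆clN x x∈V =
    let (W , W∩N) = avoid oV x∈V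
        (y , y∈W , y∈N) = V⊆clN (⊆V W (point∈ W)) (set W) (open′ W) (point∈ W)
    in W∩N y∈W y∈N

  nowhereDense⇒meagre : ∀ {N : Pred Carrier 0ℓ} → NowhereDense N → Meagre N
  nowhereDense⇒meagre {N} nd = (λ _ → N) , (λ _ → nd) , λ x∈ → 0 , x∈

  meagre-∅ : Meagre (λ _ → ⊥)
  meagre-∅ = (λ _ _ → ⊥) , (λ _ V oV V⊆ x x∈ → proj₂ (proj₂ (V⊆ x∈ V oV x∈))) , λ ()

  meagre-⊆ : ∀ {a b} {A : Pred Carrier a} {A′ : Pred Carrier b} → A ⊆ A′ → Meagre A′ → Meagre A
  meagre-⊆ A⊆A′ (N , nd , A′⊆N) = N , nd , λ x∈ → A′⊆N (A⊆A′ x∈)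

  meagre-⋃ : ∀ {a} {A : ℕ → Pred Carrier a} → (∀ k → Meagre (A k)) → Meagre (λ x → ∃[ k ] x ∈ A k)
  meagre-⋃ {A = A} m = N , (λ n → proj₁ (proj₂ (m (proj₁ (unpair n)))) (proj₂ (unpair n))) , cover
    where
    N : ℕ → Pred Carrier 0ℓ
    N n = proj₁ (m (proj₁ (unpair n))) (proj₂ (unpair n))
    cover : ∀ {x} → (∃[ k ] x ∈ A k) → ∃[ n ] x ∈ N n
    cover {x} (k , x∈) =
      let (j , x∈N) = proj₂ (proj₂ (m k)) x∈
          (n , eq) = unpair-surjective k j
      in n , subst (λ { (k , j) → x ∈ proj₁ (m k) j }) (≡.sym eq) x∈N

  meagre-∪ : ∀ {a b} {A : Pred Carrier a} {A′ : Pred Carrier b} →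
    Meagre A → Meagre A′ → Meagre (λ x → x ∈ A ⊎ x ∈ A′)
  meagre-∪ {A = A} {A′} (N , nd , A⊆N) (N′ , nd′ , A′⊆N′) = meagre-⊆ sub (meagre-⋃ {A = F} F-meagre)
    where
    F : ℕ → Pred Carrier 0ℓ
    F zero x    = ∃[ k ] x ∈ N k
    F (suc _) x = ∃[ k ] x ∈ N′ k
    F-meagre : ∀ k → Meagre (F k)
    F-meagre zero    = N , nd , λ x∈ → x∈
    F-meagre (suc _) = N′ , nd′ , λ x∈ → x∈
    sub : ∀ {x} → x ∈ A ⊎ x ∈ A′ → ∃[ k ] x ∈ F k
    sub (inj₁ x∈) = 0 , A⊆N x∈
    sub (inj₂ x∈) = 1 , A′⊆N′ x∈

  generic : ∀ {a b} {A : Pred Carrier a} {M : Pred Carrier b} → ¬ Meagre A → Meagre M → ∃[ x ] (x ∈ A × x ∉ M)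
  generic ¬mA mM = byContradiction em λ none →
    ¬mA (meagre-⊆ (λ {x} x∈A → byContradiction em λ x∉M → none (x , x∈A , x∉M)) mM)

  meagre-preimage : ∀ {φ ψ : Carrier → Carrier} → Continuous τ τ φ → Continuous τ τ ψ →
    (∀ x → Setoid._≈_ S (ψ (φ x)) x) → (∀ y → Setoid._≈_ S (φ (ψ y)) y) →
    ∀ {a} {A : Pred Carrier a} → Meagre A → Meagre (λ x → φ x ∈ A)
  meagre-preimage {φ} {ψ} φ-cont ψ-cont ψφ φψ (N , nd , A⊆N) =
    (λ k x → φ x ∈ N k) , (λ k → nowhereDense⁺ (avoid k)) , λ x∈ → A⊆N x∈
    where
    avoid : ∀ k {V} → Open V → ∀ {x} → x ∈ V → OpenAvoiding (λ x → φ x ∈ N k) V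
    avoid k {V} oV {x} x∈V
      with W , W∩N ← nowhereDense⁻ (nd k) (ψ-cont V oV) {φ x} (Open-≈ oV (Setoid.sym S (ψφ x)) x∈V) =
      record { set    = λ x → φ x ∈ set W
             ; open′  = φ-cont (set W) (open′ W)
             ; point  = ψ (point W)
             ; point∈ = Open-≈ (open′ W) (Setoid.sym S (φψ (point W))) (point∈ W)
             ; ⊆V     = λ {x} φx∈W → Open-≈ oV (ψφ x) (⊆V W φx∈W)
             } , W∩N

  EverywhereNonmeagre : ∀ {a} → Pred Carrier a → Pred Carrier 0ℓ → Set _
  EverywhereNonmeagre A V = (W : OpenIn τ V) → ¬ Meagre (λ x → x ∈ A × x ∈ set W)

  module _ {b : ℕ → Pred Carrier 0ℓ} (base : IsBase τ b) where

    opaque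
      -- Remove from `V` the countably many basic sets in which `A` is meagre. If no `W` exists,
      -- every open set meeting `V` contains such a basic set, so what remains of `V` is nowhere
      -- dense, and `A` is meagre in `V`.
      everywhereNonmeagre : ∀ {a} {A : Pred Carrier a} {V} → Open V → ¬ Meagre (λ x → x ∈ A × x ∈ V) →
        Σ[ W ∈ OpenIn τ V ] EverywhereNonmeagre A (set W)
      everywhereNonmeagre {a} {A = A} {V} oV ¬mA = byContradiction em λ none → ¬mA (meagre-⊆ split
        (meagre-∪ (meagre-⋃ {A = λ n x → x ∈ A × x ∈ b n × Meagre (A∩ (b n))} small)
                  (nowhereDense⇒meagre (boundary none))))
        where
        A∩ : Pred Carrier 0ℓ → Pred Carrier a
        A∩ W x = x ∈ A × x ∈ W
        small : ∀ n → Meagre (λ x → x ∈ A × x ∈ b n × Meagre (A∩ (b n)))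
        small n with em {P = Meagre (A∩ (b n))}
        ... | yes m = meagre-⊆ (λ { (x∈A , x∈b , _) → x∈A , x∈b }) m
        ... | no ¬m = meagre-⊆ (λ { (_ , _ , m) → ¬m m }) meagre-∅
        N : Pred Carrier 0ℓ
        N x = x ∈ V × ¬ (∃[ n ] (x ∈ b n × Resize em (Meagre (A∩ (b n)))))
        boundary : ¬ (Σ[ W ∈ OpenIn τ V ] EverywhereNonmeagre A (set W)) → NowhereDense N
        boundary none = nowhereDense⁺ avoid
          where
          avoid : ∀ {T} → Open T → ∀ {x} → x ∈ T → OpenAvoiding N T
          avoid {T} oT {x} x∈T with em {P = ∃[ y ] (y ∈ T × y ∈ V)}
          ... | no disjoint = whole oT x∈T ,
                              λ {y} y∈T (y∈V , _) → disjoint (y , y∈T , y∈V)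
          ... | yes (y , y∈T , y∈V) =
            let TV = record { set = T ∩ V ; open′ = Open-∩ oT oV ; point = y ; point∈ = y∈T , y∈V ; ⊆V = proj₂ }
                (W , ¬¬m) = ¬∀⇒∃¬ em λ nm → none (TV , nm)
                m = byContradiction em ¬¬m
                (n , p∈b , b⊆W) = proj₂ base (open′ W) (point∈ W)
            in record { set = b n ; open′ = proj₁ base n ; point = point W ; point∈ = p∈b
                      ; ⊆V = λ z∈ → proj₁ (⊆V W (b⊆W z∈)) } ,
               λ z∈b (_ , z∉) → z∉ (n , z∈b , fromWitness (meagre-⊆ (λ { (z∈A , z∈b) → z∈A , b⊆W z∈b }) m))
        split : ∀ {x} → x ∈ A × x ∈ V → (∃[ n ] (x ∈ A × x ∈ b n × Meagre (A∩ (b n)))) ⊎ x ∈ N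
        split {x} (x∈A , x∈V) with em {P = ∃[ n ] (x ∈ b n × Resize em (Meagre (A∩ (b n))))}
        ... | yes (n , x∈b , m) = inj₁ (n , x∈A , x∈b , toWitness m)
        ... | no x∉ = inj₂ (x∈V , x∉)

    -- If A has the Baire property, then A and Ess A differ by a meagre set.
    Ess : ∀ {a} → Pred Carrier a → Pred Carrier 0ℓ
    Ess A x = ∃[ n ] (x ∈ b n × Resize em (EverywhereNonmeagre A (b n)))

    Ess-open : ∀ {a} {A : Pred Carrier a} → Open (Ess A)
    Ess-open {A = A} = Open-≐
      ((λ { ((n , r) , x∈) → n , x∈ , r }) , λ { (n , x∈ , r) → (n , r) , x∈ })
      (Open-⋃ {I = Σ[ n ∈ ℕ ] Resize em (EverywhereNonmeagre A (b n))} (λ i → proj₁ base (proj₁ i)))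

    everywhereNonmeagre⇒Ess : ∀ {a} {A : Pred Carrier a} {V} → Open V → EverywhereNonmeagre A V → V ⊆ Ess A
    everywhereNonmeagre⇒Ess {A = A} oV nm x∈V = let (n , x∈b , b⊆V) = proj₂ base oV x∈V in
      n , x∈b , fromWitness λ W → nm (record { OpenIn W ; ⊆V = λ y∈ → b⊆V (⊆V W y∈) })

    Ess-nonmeagre : ∀ {a} {A : Pred Carrier a} {V} → Open V → ∀ {x} → x ∈ V → x ∈ Ess A →
      ¬ Meagre (λ y → y ∈ A × y ∈ V)
    Ess-nonmeagre oV {x} x∈V (n , x∈b , r) m = toWitness r
      (record { set = b n ∩ _ ; open′ = Open-∩ (proj₁ base n) oV ; point = x ; point∈ = x∈b , x∈V ; ⊆V = proj₁ })
      (meagre-⊆ (λ { (y∈A , _ , y∈V) → y∈A , y∈V }) m)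

    Ess-mono : ∀ {a a′} {A : Pred Carrier a} {A′ : Pred Carrier a′} → A ⊆ A′ → Ess A ⊆ Ess A′
    Ess-mono A⊆A′ (n , x∈b , r) = n , x∈b ,
      fromWitness λ W m → toWitness r W (meagre-⊆ (λ { (y∈A , y∈W) → A⊆A′ y∈A , y∈W }) m)

    Ess-satisfiable : ∀ {a} {A : Pred Carrier a} {V} → Open V → ∀ {x} → x ∈ V → x ∈ Ess A →
      ∃[ y ] (y ∈ A × y ∈ V)
    Ess-satisfiable {A = A} oV x∈V x∈ =
      let (y , y∈ , _) = generic (Ess-nonmeagre {A = A} oV x∈V x∈) meagre-∅ in y , y∈

    -- Otherwise the difference is non-meagre throughout some open `W`. Then so is `A`, which puts
    -- `W` inside `Ess A` and leaves no point of the difference in `W`.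
    A∖Ess-meagre : ∀ {a} (A : Pred Carrier a) → Meagre (λ x → x ∈ A × x ∉ Ess A)
    A∖Ess-meagre A = byContradiction em λ ¬m →
      let (W , nm) = everywhereNonmeagre {A = λ x → x ∈ A × x ∉ Ess A} Open-U
                      (λ m → ¬m (meagre-⊆ (λ x∈ → x∈ , _) m))
          (n , p∈b , b⊆W) = proj₂ base (open′ W) (point∈ W)
          W⊆Ess = everywhereNonmeagre⇒Ess {A = A} (open′ W) λ W′ m →
                    nm W′ (meagre-⊆ (λ { ((x∈A , _) , x∈) → x∈A , x∈ }) m)
      in nm (whole (open′ W) (point∈ W))
            (meagre-⊆ (λ { ((_ , x∉) , x∈W) → x∉ (W⊆Ess x∈W) }) meagre-∅)

    -- In an open set meeting `Ess A` one of the countably many pieces must be non-meagre, hence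
    -- non-meagre throughout some open subset, which then lies in the `Ess` of that piece.
    Ess∖⋃Ess-nowhereDense : ∀ {a} {A : Pred Carrier a} {A′ : ℕ → Pred Carrier a} →
      (∀ {x} → x ∈ A → ∃[ n ] x ∈ A′ n) →
      NowhereDense (λ x → x ∈ Ess A × ¬ (∃[ n ] x ∈ Ess (A′ n)))
    Ess∖⋃Ess-nowhereDense {A = A} {A′} cover = nowhereDense⁺ λ {T} oT {x} x∈T → avoid oT x∈T
      where
      avoid : ∀ {T} → Open T → ∀ {x} → x ∈ T →
        OpenAvoiding (λ y → y ∈ Ess A × ¬ (∃[ n ] y ∈ Ess (A′ n))) T
      avoid {T} oT {x} x∈T with em {P = ∃[ y ] (y ∈ T × y ∈ Ess A)}
      ... | no disjoint = whole oT x∈T ,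
                          λ {y} y∈T (y∈ , _) → disjoint (y , y∈T , y∈)
      ... | yes (y , y∈T , y∈) =
        let (n , ¬m) = ¬∀⇒∃¬ em λ m → Ess-nonmeagre {A = A} oT y∈T y∈
                         (meagre-⊆ (λ { {y} (y∈A , y∈T) → let (n , y∈) = cover y∈A in n , y∈ , y∈T })
                           (meagre-⋃ {A = λ n y → y ∈ A′ n × y ∈ T} m))
            (W , nm) = everywhereNonmeagre {A = A′ n} oT ¬m
        in W , λ y∈W (_ , none) → none (n , everywhereNonmeagre⇒Ess {A = A′ n} (open′ W) nm y∈W)

-- Polish spaces and a countable base of balls.

opaque
  dyadic : ℕ → ℚ
  dyadic-pos : ∀ n → 0ℚ ℚ.< dyadic n

  dyadic zero    = 1ℚ
  dyadic (suc n) = proj₁ (halve (dyadic-pos n))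

  dyadic-pos zero    = ℚ.positive⁻¹ 1ℚ
  dyadic-pos (suc n) = proj₁ (proj₂ (halve (dyadic-pos n)))

  dyadic-small : ∀ {ε} → 0ℚ ℚ.< ε → ∃[ n ] dyadic n ℚ.≤ ε
  dyadic-small = halving⇒small dyadic (λ n → proj₂ (proj₂ (halve (dyadic-pos n))))

module PolishSpace {S : Setoid 0ℓ 0ℓ} {τ : Topology S} (polish : IsPolish τ) where
  open Setoid S using (Carrier)
  open Topology τ using (Open; Open-∩; Open-U)
  open IsPolish polish public using (complete) renaming (metric to ρ)
  open IsPolish polish using (compatible; separable)

  ball-open : ∀ c q → Open (B ρ c q)
  ball-open c q = proj₂ (compatible _) (B-open ρ c q)

  opaque
    inner-ball : ∀ {V} → Open V → ∀ {x} → x ∈ V → ∃[ q ] (0ℚ ℚ.< q × B ρ x q ⊆ V)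
    inner-ball oV = open⇒ball ρ (proj₁ (compatible _) oV)

  open-local : ∀ {W : Pred Carrier 0ℓ} →
    (∀ {x} → x ∈ W → Σ[ V ∈ Pred Carrier 0ℓ ] (Open V × x ∈ V × V ⊆ W)) → Open W
  open-local nbhd = proj₂ (compatible _) (balls⇒open ρ λ x∈W →
    let (V , oV , x∈V , V⊆W) = nbhd x∈W
        (q , 0<q , q⊆V) = inner-ball oV x∈V
    in q , 0<q , λ y∈ → V⊆W (q⊆V y∈))

  dyadicBall : ℕ × ℕ → Carrier × ℚ
  dyadicBall (k , j) = proj₁ separable k , dyadic j

  baseBall : ℕ → Carrier × ℚ
  baseBall n = dyadicBall (unpair n)

  b : ℕ → Pred Carrier 0ℓ
  b n = uncurry (B ρ) (baseBall n)

  baseBall-pos : ∀ n → 0ℚ ℚ.< proj₂ (baseBall n)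
  baseBall-pos n = dyadic-pos (proj₂ (unpair n))

  opaque
    small-baseBall : ∀ {V} → Open V → ∀ {x} → x ∈ V → ∀ {ε} → 0ℚ ℚ.< ε →
      ∃[ n ] (x ∈ b n × b n ⊆ V × proj₂ (baseBall n) ℚ.≤ ε)
    small-baseBall {V} oV {x} x∈V {ε} 0<ε
      with q , 0<q , q⊆V ← inner-ball oV x∈V
      with p , 0<p , 2p≤q ← halve 0<q
      -- A ball of radius at most `p` that contains `x` stays within 2p of `x`, hence inside `V`;
      -- the bound by `ε` is the one demanded.
      with j , r≤ ← dyadic-small (0<⊓ p ε 0<p 0<ε)
      with k , s∈ ← proj₂ separable (B ρ x (dyadic j)) (ball-open x (dyadic j)) (x , B-refl ρ x (dyadic-pos j))
      with n , eq ← unpair-surjective k j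
      with r≤p ← ℚ.≤-trans r≤ (ℚ.p⊓q≤p p ε) =
      n , subst (λ i → x ∈ uncurry (B ρ) (dyadicBall i) × uncurry (B ρ) (dyadicBall i) ⊆ V ×
                       proj₂ (dyadicBall i) ℚ.≤ ε) (≡.sym eq)
        (B-sym ρ s∈ ,
         (λ y∈ → q⊆V (B-mono ρ (ℚ.≤-trans (ℚ.+-mono-≤ r≤p r≤p) 2p≤q) (B-triangle ρ s∈ y∈))) ,
         ℚ.≤-trans r≤ (ℚ.p⊓q≤q p ε))

  isBase : IsBase τ b
  isBase = (λ n → uncurry ball-open (baseBall n)) , λ oV x∈V →
    let (n , x∈b , b⊆V , _) = small-baseBall oV x∈V (ℚ.positive⁻¹ 1ℚ) in n , x∈b , b⊆V

  opaque
    shrinking-baseBall : ∀ {c q x} → x ∈ B ρ c q → ∃[ n ] (x ∈ b n × Shrinks ρ (c , q) (baseBall n))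
    shrinking-baseBall {c} {q} {x} x∈ =
      let (p , x∈p , p<q) = rounded (Metric.dist ρ c x) x∈
          (δ , 0<δ , p+δ≡q) = slack p<q
          -- The new centre is within p + r of `c`, so p + 3r has to fit below `q`; taking r at most
          -- a quarter of the slack `δ` is enough.
          (δ′ , 0<δ′ , 2δ′≤δ) = halve 0<δ
          (ε , 0<ε , 2ε≤δ′) = halve 0<δ′
          (n , x∈b , _ , r≤ε) = small-baseBall Open-U {x} _ 0<ε
          r = proj₂ (baseBall n)
          2r≤δ′ = ℚ.≤-trans (ℚ.+-mono-≤ r≤ε r≤ε) 2ε≤δ′
      in n , x∈b , p ℚ.+ r , B-triangle ρ x∈p (B-sym ρ x∈b) , (begin
        p ℚ.+ r ℚ.+ (r ℚ.+ r)             ≤⟨ ℚ.+-mono-≤ (ℚ.+-monoʳ-≤ p (p≤q+p (baseBall-pos n))) ℚ.≤-refl ⟩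
        p ℚ.+ (r ℚ.+ r) ℚ.+ (r ℚ.+ r)     ≡⟨ ℚ.+-assoc p _ _ ⟩
        p ℚ.+ (r ℚ.+ r ℚ.+ (r ℚ.+ r))     ≤⟨ ℚ.+-monoʳ-≤ p (ℚ.+-mono-≤ 2r≤δ′ 2r≤δ′) ⟩
        p ℚ.+ (δ′ ℚ.+ δ′)                 ≤⟨ ℚ.+-monoʳ-≤ p 2δ′≤δ ⟩
        p ℚ.+ δ                           ≡⟨ p+δ≡q ⟩
        q                                 ∎)
      where
      open ℚ.≤-Reasoning

-- Projections of closed sets and the Baire property.

module Projection (em : ∀ {ℓ} → ExcludedMiddle ℓ)
  {S : Setoid 0ℓ 0ℓ} {τ : Topology S} (polish : IsPolish τ)
  {S′ : Setoid 0ℓ 0ℓ} (τ′ : Topology S′) {b′ : ℕ → Pred (Setoid.Carrier S′) 0ℓ} (base′ : IsBase τ′ b′)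
  (F : Pred (Setoid.Carrier S × Setoid.Carrier S′) 0ℓ) (F-closed : Topology.Closed (τ ⊗ τ′) F) where

  open PolishSpace polish
  open Category em τ′
  open Topology τ′ using (NowhereDense; Meagre; Open-U)

  Image : ℕ → Pred (Setoid.Carrier S′) 0ℓ
  Image n y = ∃[ f ] (f ∈ b n × (f , y) ∈ F)

  -- The guard empties the set unless ball `m` sits well inside ball `n`, so the pieces of `Image n`
  -- can be indexed by all `m`.
  Children : ℕ → ℕ → Pred (Setoid.Carrier S′) 0ℓ
  Children n m y = Shrinks ρ (baseBall n) (baseBall m) × y ∈ Image m

  -- The points at which a descent through ever smaller balls gets stuck at ball `n`.
  Branchless : ℕ → Pred (Setoid.Carrier S′) 0ℓ
  Branchless n y = y ∈ Ess base′ (Image n) × ¬ (∃[ m ] y ∈ Ess base′ (Children n m))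

  Branchless-nowhereDense : ∀ n → NowhereDense (Branchless n)
  Branchless-nowhereDense n = Ess∖⋃Ess-nowhereDense base′ {A = Image n} {A′ = Children n}
    λ { (f , f∈b , Ffy) → let (m , f∈b′ , shrinks) = shrinking-baseBall f∈b in m , shrinks , f , f∈b′ , Ffy }

  -- A point of Ess (Image n) outside every Branchless set starts an infinite branch of shrinking
  -- balls, whose limit is a preimage: Souslin's scheme for the projection of a closed set.
  Ess∖Branchless⊆Image : ∀ {y} → ¬ (∃[ m ] y ∈ Branchless m) → ∀ n → y ∈ Ess base′ (Image n) → y ∈ Image n
  Ess∖Branchless⊆Image {y} y∉ n₀ y∈ = f , f∈ 0 , byContradiction em ¬¬Ffy
    where
    Node : Set
    Node = Σ[ n ∈ ℕ ] y ∈ Ess base′ (Image n)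

    opaque
      child : (u : Node) → Σ[ v ∈ Node ] Shrinks ρ (baseBall (proj₁ u)) (baseBall (proj₁ v))
      child (n , y∈)
        with m , y∈′ ← byContradiction em (λ none → y∉ (n , y∈ , none))
        -- Any element of `Children n m` will do: it is picked only to read off the guard.
        with _ , (shrinks , _) , _ ← Ess-satisfiable base′ {A = Children n m} Open-U {y} _ y∈′ =
        (m , Ess-mono base′ proj₂ y∈′) , shrinks

    branch : ℕ → Node
    branch zero    = n₀ , y∈
    branch (suc k) = proj₁ (child (branch k))

    ball : ℕ → Setoid.Carrier S × ℚ
    ball k = baseBall (proj₁ (branch k))

    shrinking : Shrinking ρ ball
    shrinking k = proj₂ (child (branch k))

    limit : ∃[ f ] (∀ k → f ∈ uncurry (B ρ) (ball k))
    limit = shrinking-limit ρ complete ball (λ k → baseBall-pos (proj₁ (branch k))) shrinking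

    f = proj₁ limit
    f∈ = proj₂ limit

    -- A box around (f , y) missing `F` would contain a whole ball of the branch in its first
    -- factor, but points of the image of that ball occur arbitrarily near `y`.
    ¬¬Ffy : ¬ ((f , y) ∉ F)
    ¬¬Ffy ¬Ffy
      with V , V′ , oV , oV′ , f∈V , y∈V′ , disjoint ← F-closed ¬Ffy
      with q , 0<q , q⊆V ← inner-ball oV f∈V
      with k , k⊆q ← shrinking-absorbed ρ ball shrinking f∈ 0<q
      with y′ , (f′ , f′∈ , Ff′y′) , y′∈V′ ←
             Ess-satisfiable base′ {A = Image (proj₁ (branch k))} oV′ y∈V′ (proj₂ (branch k)) =
      disjoint (q⊆V (k⊆q f′∈)) y′∈V′ Ff′y′

  Ess∖Image-meagre : Meagre (λ y → ∃[ n ] (y ∈ Ess base′ (Image n) × y ∉ Image n))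
  Ess∖Image-meagre = meagre-⊆
    (λ { {y} (n , y∈ , y∉) → byContradiction em λ y∉′ → y∉ (Ess∖Branchless⊆Image y∉′ n y∈) })
    (meagre-⋃ {A = Branchless} (λ n → nowhereDense⇒meagre (Branchless-nowhereDense n)))

-- The Kuratowski-Ulam theorem for finite powers.

module KuratowskiUlam (em : ∀ {ℓ} → ExcludedMiddle ℓ) {S : Setoid 0ℓ 0ℓ} (τ : Topology S)
  {b : ℕ → Pred (Setoid.Carrier S) 0ℓ} (base : IsBase τ b) where

  open Setoid S using (Carrier)
  open Category em

  box-open : ∀ {n} {V : Fin n → Pred Carrier 0ℓ} → (∀ i → Topology.Open τ (V i)) →
    Topology.Open (power τ n) (λ x → ∀ i → x i ∈ V i)
  box-open {V = V} oV x∈ = V , oV , x∈ , λ y∈ → y∈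

  ∷-open : ∀ {n} {V : Pred (Fin n → Carrier) 0ℓ} {W : Pred Carrier 0ℓ} →
    Topology.Open (power τ n) V → Topology.Open τ W →
    Topology.Open (power τ (suc n)) (λ z → Vec.head z ∈ W × Vec.tail z ∈ V)
  ∷-open {V = V} {W} oV oW {z} (z₀∈W , zs∈V) =
    let (A , oA , a , A⊆V) = oV zs∈V in
    (W Vec.∷ A) ,
    (λ { zero → oW ; (suc i) → oA i }) ,
    (λ { zero → z₀∈W ; (suc i) → a i }) ,
    λ y∈ → y∈ zero , A⊆V (λ i → y∈ (suc i))

  fibre : ∀ {a n} → Pred (Fin (suc n) → Carrier) a → (Fin n → Carrier) → Pred Carrier a
  fibre M x y = (y Vec.∷ x) ∈ M

  module _ {n} (N : Pred (Fin (suc n) → Carrier) 0ℓ) (nd : Topology.NowhereDense (power τ (suc n)) N) where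

    -- Nowhere density of `N` along the basic set `b j`, uniformly near `x`. The premise allows for
    -- an empty `b j`, inside which no `OpenIn` exists.
    Clears : ℕ → (Fin n → Carrier) → Set₁
    Clears j x = Σ[ V ∈ Pred (Fin n → Carrier) 0ℓ ] (Topology.Open (power τ n) V × x ∈ V ×
      ((∃[ y ] y ∈ b j) → Σ[ W ∈ OpenIn τ (b j) ] (∀ {x y} → x ∈ V → y ∈ set W → (y Vec.∷ x) ∉ N)))

    Bad : ℕ → Pred (Fin n → Carrier) 0ℓ
    Bad j x = Resize em (¬ Clears j x)

    -- Some box inside the product of `b j` and `V` misses `N`. Its factor in the tuples is open,
    -- and the remaining factor clears all of its points at once.
    Bad-nowhereDense : ∀ j → Topology.NowhereDense (power τ n) (Bad j)
    Bad-nowhereDense j = nowhereDense⁺ (power τ n) avoid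
      where
      avoid : ∀ {V} → Topology.Open (power τ n) V → ∀ {x} → x ∈ V → OpenAvoiding (power τ n) (Bad j) V
      avoid {V} oV {x} x∈V with em {P = ∃[ y ] y ∈ b j}
      ... | no empty = whole {τ = power τ n} (λ {y} → oV {y}) x∈V ,
                       λ y∈ bad → toWitness bad (V , (λ {y} → oV {y}) , y∈ , λ nonempty → ⊥-elim (empty nonempty))
      ... | yes (y , y∈b)
        with W , W∩N ← nowhereDense⁻ (power τ (suc n)) nd
               (λ {z} → ∷-open {V = V} {W = b j} (λ {y} → oV {y}) (proj₁ base j) {z}) {y Vec.∷ x} (y∈b , x∈V)
        with A , oA , a , A⊆W ← open′ W (point∈ W) =
        record { set = V′ ; open′ = box-open (λ i → oA (suc i)) ; point = Vec.tail (point W)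
               ; point∈ = λ i → a (suc i) ; ⊆V = λ x∈ → proj₂ (⊆V W (A⊆W (join (a zero) x∈))) } ,
        λ x∈ bad → toWitness bad (V′ , box-open (λ i → oA (suc i)) , x∈ , λ _ →
          record { set = A zero ; open′ = oA zero ; point = Vec.head (point W) ; point∈ = a zero
                 ; ⊆V = λ y∈ → proj₁ (⊆V W (A⊆W (join y∈ (λ i → a (suc i))))) } ,
          λ x∈ y∈ → W∩N (A⊆W (join y∈ x∈)))
        where
        V′ : Pred (Fin n → Carrier) 0ℓ
        V′ x = ∀ i → x i ∈ A (suc i)
        join : ∀ {x y} → y ∈ A zero → x ∈ V′ → ∀ i → (y Vec.∷ x) i ∈ A i
        join y∈ x∈ zero    = y∈
        join y∈ x∈ (suc i) = x∈ i

    fibre-nowhereDense : ∀ {x} → ¬ (∃[ j ] x ∈ Bad j) → Topology.NowhereDense τ (fibre N x)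
    fibre-nowhereDense {x} good = nowhereDense⁺ τ avoid
      where
      avoid : ∀ {V} → Topology.Open τ V → ∀ {y} → y ∈ V → OpenAvoiding τ (fibre N x) V
      avoid oV {y} y∈V
        with j , y∈b , b⊆V ← proj₂ base oV y∈V
        with V , oV′ , x∈V′ , clear ← byContradiction em
               (λ ¬clears → good (j , fromWitness {a? = em {P = ¬ Clears j x}} ¬clears))
        with W , W∩N ← clear (y , y∈b) =
        record { OpenIn W ; ⊆V = λ z∈ → b⊆V (⊆V W z∈) } , λ z∈ → W∩N x∈V′ z∈

  -- Outside the countable union of the sets `Bad`, over all `N k` and all basic sets, every fibre
  -- of every `N k` is nowhere dense.
  fibre-meagre : ∀ {a n} {M : Pred (Fin (suc n) → Carrier) a} → Topology.Meagre (power τ (suc n)) M →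
    Topology.Meagre (power τ n) (λ x → ¬ Topology.Meagre τ (fibre M x))
  fibre-meagre {M = M} (N , nd , M⊆N) = meagre-⊆ (power τ _) bad
    (meagre-⋃ (power τ _) (λ k → Bad (N k) (nd k) , Bad-nowhereDense (N k) (nd k) , λ x∈ → x∈))
    where
    bad : ∀ {x} → ¬ Topology.Meagre τ (fibre M x) → ∃[ k ] ∃[ j ] x ∈ Bad (N k) (nd k) j
    bad ¬m = byContradiction em λ good → ¬m
      ((λ k → fibre (N k) _) , (λ k → fibre-nowhereDense (N k) (nd k) (λ (j , x∈) → good (k , j , x∈))) , M⊆N)

-- Polish groups.

module PolishGroup {G : Group 0ℓ 0ℓ} {τ : Topology (Group.setoid G)} (isPolishGroup : IsPolishGroup G τ) where
  open Group G renaming (_≈_ to _≈ᴳ_)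
  open Algebra.Properties.Group G
  open IsPolishGroup isPolishGroup
  open PolishSpace isPolish public
  open Topology τ

  id-continuous : Continuous τ τ (λ x → x)
  id-continuous V oV = oV

  const-continuous : ∀ c → Continuous τ τ (λ _ → c)
  const-continuous c V oV = open-local λ c∈V → U , Open-U , _ , λ _ → c∈V

  ∙-nbhds : ∀ {V} → Open V → ∀ {x y} → x ∙ y ∈ V →
    Σ[ A ∈ Pred Carrier 0ℓ ] Σ[ A′ ∈ Pred Carrier 0ℓ ]
      (Open A × Open A′ × x ∈ A × y ∈ A′ × (∀ {x′ y′} → x′ ∈ A → y′ ∈ A′ → x′ ∙ y′ ∈ V))
  ∙-nbhds {V} oV xy∈V = ∙-continuous V oV xy∈V

  ∙-continuous₂ : ∀ {φ ψ} → Continuous τ τ φ → Continuous τ τ ψ → Continuous τ τ (λ x → φ x ∙ ψ x)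
  ∙-continuous₂ {φ} {ψ} φ-cont ψ-cont V oV = open-local λ {x} x∈ →
    let (A , A′ , oA , oA′ , x∈A , x∈A′ , A∙A′⊆V) = ∙-nbhds oV x∈ in
    (λ x → φ x ∈ A × ψ x ∈ A′) , Open-∩ (φ-cont A oA) (ψ-cont A′ oA′) , (x∈A , x∈A′) ,
    λ { (y∈A , y∈A′) → A∙A′⊆V y∈A y∈A′ }

  ∙ˡ-continuous : ∀ c → Continuous τ τ (c ∙_)
  ∙ˡ-continuous c = ∙-continuous₂ (const-continuous c) id-continuous

  ∙ʳ-continuous : ∀ c → Continuous τ τ (_∙ c)
  ∙ʳ-continuous c = ∙-continuous₂ id-continuous (const-continuous c)

  \\-nbhds : ∀ {V} → Open V → ∀ {x y} → x ⁻¹ ∙ y ∈ V →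
    Σ[ A ∈ Pred Carrier 0ℓ ] Σ[ A′ ∈ Pred Carrier 0ℓ ]
      (Open A × Open A′ × x ∈ A × y ∈ A′ × (∀ {x′ y′} → x′ ∈ A → y′ ∈ A′ → x′ ⁻¹ ∙ y′ ∈ V))
  \\-nbhds oV x⁻¹y∈V = let (A , A′ , oA , oA′ , x∈A , y∈A′ , sub) = ∙-nbhds oV x⁻¹y∈V in
    (λ x → x ⁻¹ ∈ A) , A′ , ⁻¹-continuous A oA , oA′ , x∈A , y∈A′ , sub

  //-nbhds : ∀ {V} → Open V → ∀ {x y} → x ∙ y ⁻¹ ∈ V →
    Σ[ A ∈ Pred Carrier 0ℓ ] Σ[ A′ ∈ Pred Carrier 0ℓ ]
      (Open A × Open A′ × x ∈ A × y ∈ A′ × (∀ {x′ y′} → x′ ∈ A → y′ ∈ A′ → x′ ∙ y′ ⁻¹ ∈ V))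
  //-nbhds oV xy⁻¹∈V = let (A , A′ , oA , oA′ , x∈A , y∈A′ , sub) = ∙-nbhds oV xy⁻¹∈V in
    A , (λ y → y ⁻¹ ∈ A′) , oA , ⁻¹-continuous A′ oA′ , x∈A , y∈A′ , sub

  opaque
    small-quotients : ∀ {W} → Open W → ε ∈ W → ∀ f →
      ∃[ m ] (f ∈ b m × (∀ {f₁ f₂} → f₁ ∈ b m → f₂ ∈ b m → f₁ ∙ f₂ ⁻¹ ∈ W))
    small-quotients oW ε∈W f =
      let (T , T′ , oT , oT′ , f∈T , f∈T′ , T//T′⊆W) = //-nbhds oW {f} {f} (Open-≈ oW (sym (inverseʳ f)) ε∈W)
          (m , f∈b , b⊆) = proj₂ isBase (Open-∩ oT oT′) {f} (f∈T , f∈T′)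
      in m , f∈b , λ f₁∈ f₂∈ → T//T′⊆W (proj₁ (b⊆ f₁∈)) (proj₂ (b⊆ f₂∈))

  conj-continuous : ∀ g → Continuous τ τ (λ k → k ∙ g ∙ k ⁻¹)
  conj-continuous g = ∙-continuous₂ (∙ʳ-continuous g) ⁻¹-continuous

  module _ (em : ∀ {ℓ} → ExcludedMiddle ℓ) where
    open Category em τ

    translateˡ-meagre : ∀ c {a} {A : Pred Carrier a} → Meagre A → Meagre (λ x → c ∙ x ∈ A)
    translateˡ-meagre c {A = A} = meagre-preimage {ψ = c ⁻¹ ∙_} (∙ˡ-continuous c) (∙ˡ-continuous (c ⁻¹))
      (\\-leftDividesʳ c) (\\-leftDividesˡ c) {A = A}

    translateʳ-meagre : ∀ c {a} {A : Pred Carrier a} → Meagre A → Meagre (λ x → x ∙ c ∈ A)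
    translateʳ-meagre c {A = A} = meagre-preimage {ψ = _∙ c ⁻¹} (∙ʳ-continuous c) (∙ʳ-continuous (c ⁻¹))
      (//-rightDividesʳ c) (//-rightDividesˡ c) {A = A}

    -- By separability countably many translates of `V` cover the group, so a meagre `V` would make
    -- every set meagre, `A` included.
    open-nonmeagre : ∀ {a} {A : Pred Carrier a} → ¬ Meagre A → ∀ {V} → Open V → ∀ {x} → x ∈ V → ¬ Meagre V
    open-nonmeagre ¬mA {V} oV {v} v∈V mV = ¬mA (meagre-⊆ (λ {x} _ → cover x)
      (meagre-⋃ {A = λ k x → s k ∙ x ∈ V} λ k → translateˡ-meagre (s k) mV))
      where
      s = proj₁ (IsPolish.separable isPolish)
      cover : ∀ x → ∃[ k ] s k ∙ x ∈ V
      cover x = proj₂ (IsPolish.separable isPolish) (λ g → g ∙ x ∈ V) (∙ʳ-continuous x V oV)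
        (v ∙ x ⁻¹ , Open-≈ oV (sym (//-rightDividesˡ x v)) v∈V)

-- Graded subgroups and their continuity at the identity.

module Graded {G : Group 0ℓ 0ℓ} (𝓗 : GradedSubgroup G) where
  open Group G renaming (_≈_ to _≈ᴳ_)
  open GradedSubgroup 𝓗 public

  H-resp : ∀ {x y q} → x ≈ᴳ y → q ∈ Upper (H x) → q ∈ Upper (H y)
  H-resp x≈y = proj₂ (H-cong x≈y)

  H-inverse : ∀ {x q} → q ∈ Upper (H x) → q ∈ Upper (H (x ⁻¹))
  H-inverse {x} = proj₂ (H-⁻¹ x)

  H-product : ∀ {x y p q} → p ∈ Upper (H x) → q ∈ Upper (H y) → p ℚ.+ q ∈ Upper (H (x ∙ y))
  H-product {x} {y} {p} {q} Hx<p Hy<q = H-∙ x y (p , q , Hx<p , Hy<q , ℚ.≤-refl)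

  H-mono : ∀ {x p q} → p ℚ.≤ q → p ∈ Upper (H x) → q ∈ Upper (H x)
  H-mono {x} p≤q Hx<p = upward (H x) Hx<p p≤q

module ContinuityAtIdentity {G : Group 0ℓ 0ℓ} {τ : Topology (Group.setoid G)}
  (isPolishGroup : IsPolishGroup G τ) (𝓗 : GradedSubgroup G) where
  open Group G renaming (_≈_ to _≈ᴳ_)
  open Algebra.Properties.Group G
  open PolishGroup isPolishGroup
  open Graded 𝓗
  open Topology τ

  SmallNearIdentity : ℚ → Set₁
  SmallNearIdentity t = Σ[ V ∈ Pred Carrier 0ℓ ] (Open V × ε ∈ V × (∀ {g} → g ∈ V → t ∈ Upper (H g)))

  -- For `g` near the identity `V` and its translate by `g⁻¹` overlap in a non-empty open set, so
  -- some `x` has both `H x` and `H (x ∙ g)` below `s`; and `g` is `x ⁻¹ ∙ (x ∙ g)`.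
  pettis : (em : ∀ {ℓ} → ExcludedMiddle ℓ) → (∀ {V} → Open V → ∀ {x} → x ∈ V → ¬ Meagre V) →
    ∀ {s V} → Open V → ∀ {v} → v ∈ V → Meagre (λ x → s ∉ Upper (H x) × x ∈ V) → SmallNearIdentity (s ℚ.+ s)
  pettis em nonmeagre {s} {V} oV {v} v∈V m =
    (λ g → v ∙ g ∈ V) , ∙ˡ-continuous v V oV , Open-≈ oV (sym (identityʳ v)) v∈V , λ {g} vg∈V →
    let (x , (x∈V , xg∈V) , x∉) = generic (nonmeagre (Open-∩ oV (∙ʳ-continuous g V oV)) {v} (v∈V , vg∈V))
                                          (meagre-∪ m (translateʳ-meagre em g m))
        Hx<s  = byContradiction em λ Hx≥s → x∉ (inj₁ (Hx≥s , x∈V))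
        Hxg<s = byContradiction em λ Hxg≥s → x∉ (inj₂ (Hxg≥s , xg∈V))
    in H-resp (\\-leftDividesʳ x g) (H-product (H-inverse Hx<s) Hxg<s)
    where open Category em τ

  module _ (small : ∀ {t} → 0ℚ ℚ.< t → SmallNearIdentity t) where

    near : ∀ x {δ} → 0ℚ ℚ.< δ →
      Σ[ V ∈ Pred Carrier 0ℓ ] (Open V × x ∈ V × (∀ {y} → y ∈ V → δ ∈ Upper (H (x ⁻¹ ∙ y))))
    near x 0<δ = let (V , oV , ε∈V , V⊆) = small 0<δ in
      (λ y → x ⁻¹ ∙ y ∈ V) , ∙ˡ-continuous (x ⁻¹) V oV , Open-≈ oV (sym (inverseˡ x)) ε∈V , V⊆

    upperSemicontinuous : UpperSemicontinuous H
    upperSemicontinuous r = open-local nbhd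
      where
      nbhd : ∀ {x} → H x < r → Σ[ V ∈ Pred Carrier 0ℓ ] (Open V × x ∈ V × V ⊆ (λ y → H y < r))
      nbhd {x} (q , Hx<q , r≮q)
        with p , Hx<p , p<q ← rounded (H x) Hx<q
        with δ , 0<δ , p+δ≡q ← slack p<q
        with V , oV , x∈V , V⊆ ← near x 0<δ =
        V , oV , x∈V , λ {y} y∈V → q ,
          H-mono (ℚ.≤-reflexive p+δ≡q) (H-resp (\\-leftDividesˡ x y) (H-product Hx<p (V⊆ y∈V))) , r≮q

    -- Since `x` is `y ∙ (x ⁻¹ ∙ y) ⁻¹`, the value `H y` cannot fall below `H x` by more than
    -- `H (x ⁻¹ ∙ y)`.
    above-open : ∀ r → Open (λ x → r < H x)
    above-open r = open-local nbhd
      where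
      nbhd : ∀ {x} → r < H x → Σ[ V ∈ Pred Carrier 0ℓ ] (Open V × x ∈ V × V ⊆ (λ y → r < H y))
      nbhd {x} (q , r<q , Hx≮q)
        with p , r<p , p<q ← rounded r r<q
        with δ , 0<δ , p+δ≡q ← slack p<q
        with V , oV , x∈V , V⊆ ← near x 0<δ =
        V , oV , x∈V , λ {y} y∈V → p , r<p , λ Hy<p →
          Hx≮q (H-mono (ℚ.≤-reflexive p+δ≡q) (H-resp (x≈ y) (H-product Hy<p (H-inverse (V⊆ y∈V)))))
        where
        x≈ : ∀ y → y ∙ (x ⁻¹ ∙ y) ⁻¹ ≈ᴳ x
        x≈ y = trans (∙-congˡ (trans (⁻¹-anti-homo-∙ (x ⁻¹) y) (∙-congˡ (⁻¹-involutive x)))) (\\-leftDividesˡ y x)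

    continuous : Continuous[0,∞] τ H
    continuous V oV = open-local λ x∈ →
      let (rays , x∈rays , rays⊆V) = oV x∈
          (W , oW , x∈W , W⊆rays) = rays-nbhd x∈rays
      in W , oW , x∈W , λ y∈W → rays⊆V (W⊆rays y∈W)
      where
      ray-open : ∀ ray → Open (λ y → H y ∈ᴿ ray)
      ray-open (below r) = upperSemicontinuous r
      ray-open (above r) = above-open r

      rays-nbhd : ∀ {x rays} → All (H x ∈ᴿ_) rays →
        Σ[ W ∈ Pred Carrier 0ℓ ] (Open W × x ∈ W × (∀ {y} → y ∈ W → All (H y ∈ᴿ_) rays))
      rays-nbhd [] = U , Open-U , _ , λ _ → []
      rays-nbhd {rays = ray ∷ _} (p ∷ ps) = let (W , oW , x∈W , W⊆) = rays-nbhd ps in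
        (λ y → H y ∈ᴿ ray) ∩ W , Open-∩ (ray-open ray) oW , (p , x∈W) ,
        λ { (q , y∈W) → q ∷ W⊆ y∈W }

-- Cantor schemes.

prefix : (ℕ → Bool) → ℕ → List Bool
prefix a zero    = []
prefix a (suc n) = a n ∷ prefix a n

length-prefix : ∀ a n → length (prefix a n) ≡ n
length-prefix a zero    = refl
length-prefix a (suc n) = ≡.cong suc (length-prefix a n)

prefix-≢ : ∀ a b {m} → prefix a m ≢ prefix b m → ∀ k → prefix a (k ℕ.+ m) ≢ prefix b (k ℕ.+ m)
prefix-≢ a b a≢b zero    e = a≢b e
prefix-≢ a b a≢b (suc k) e = prefix-≢ a b a≢b k (List.∷-injectiveʳ e)

first-difference : ∀ a b n → prefix a n ≢ prefix b n → ∃[ m ] (prefix a m ≡ prefix b m × a m ≢ b m)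
first-difference a b zero    a≢b = ⊥-elim (a≢b refl)
first-difference a b (suc n) a≢b with List.≡-dec Bool._≟_ (prefix a n) (prefix b n)
... | yes e = n , e , λ eₙ → a≢b (≡.cong₂ _∷_ eₙ e)
... | no a≢b′ = first-difference a b n a≢b′

module _ {S : Setoid 0ℓ 0ℓ} (ρ : Metric S) where
  open Setoid S using (Carrier)

  record CantorScheme : Set where
    field
      ball    : List Bool → Carrier × ℚ
      pos     : ∀ s → 0ℚ ℚ.< proj₂ (ball s)
      shrinks : ∀ i s → Shrinks ρ (ball s) (ball (i ∷ s))

    Branch : (ℕ → Bool) → Pred Carrier 0ℓ
    Branch a x = ∀ n → x ∈ uncurry (B ρ) (ball (prefix a n))

    branch-shrinking : ∀ a → Shrinking ρ (λ n → ball (prefix a n))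
    branch-shrinking a n = shrinks (a n) (prefix a n)

    branch-limit : Metric.Complete ρ → ∀ a → ∃[ x ] x ∈ Branch a
    branch-limit complete a = shrinking-limit ρ complete _ (λ n → pos (prefix a n)) (branch-shrinking a)

    -- The split is oriented because the two children of a node may be built differently; the other
    -- order is recovered by exchanging the branches.
    Separates : ∀ {ℓ} → (Carrier → Carrier → Set ℓ) → Set ℓ
    Separates R = ∀ {a b} n → prefix a n ≡ prefix b n → a n ≡ false → b n ≡ true →
      ∀ {x y} → x ∈ Branch a → y ∈ Branch b → R x y

-- Separated Cantor schemes force a large index.

module Index (em : ∀ {ℓ} → ExcludedMiddle ℓ) (ac : ∀ {a ℓ} → AxiomOfChoice a ℓ)
  {G : Group 0ℓ 0ℓ} (ρ : Metric (Group.setoid G)) (complete : Metric.Complete ρ)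
  (𝓗 : GradedSubgroup G) (small-index : IndexLessThan 2^ℵ₀ 𝓗) where
  open Group G hiding (refl) renaming (_≈_ to _≈ᴳ_)
  open Algebra.Properties.Group G
  open Graded 𝓗

  -- Assign to each branch a point of the dense set `D` within r/2 of a limit of the branch. Two
  -- branches sharing this point would have limits closer than `r`, so the continuum would inject
  -- into `D`.
  not-separated : (scheme : CantorScheme ρ) → ∀ {r} → 0ℚ ℚ.< r →
    ¬ CantorScheme.Separates scheme (λ x y → r ∉ Upper (H (x ⁻¹ ∙ y)))
  not-separated scheme {r} 0<r separates with p , 0<p , 2p≤r ← halve 0<r =
    proj₂ (proj₂ (proj₂ small-index)) injection
    where
    open CantorScheme scheme
    D = proj₁ small-index

    Approximation : Set
    Approximation = Σ[ a ∈ (ℕ → Bool) ] Σ[ h ∈ Carrier ]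
      (h ∈ D × ∃[ x ] (x ∈ Branch a × p ∈ Upper (H (x ⁻¹ ∙ h))))

    -- Equality looks at `a` and `h` only, so a congruent section sends pointwise equal sequences to
    -- equal points of `D`, as an injection of setoids must.
    Approximations : Setoid 0ℓ 0ℓ
    Approximations = On.setoid {B = Approximation} (×-setoid 2^ℵ₀ setoid) (λ (a , h , _) → a , h)

    approximate : ∀ a → Σ[ h ∈ Carrier ] (h ∈ D × ∃[ x ] (x ∈ Branch a × p ∈ Upper (H (x ⁻¹ ∙ h))))
    approximate a =
      let (x , x∈) = branch-limit complete a
          (h , h∈D , close) = proj₁ (proj₂ small-index) x (cut p 0<p) (0<cut 0<p)
      in h , h∈D , x , x∈ , <cut (H (x ⁻¹ ∙ h)) 0<p close

    choice = ac {A = Approximations} {B = 2^ℵ₀} record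
      { to         = proj₁
      ; cong       = proj₁
      ; surjective = λ a → (a , approximate a) , λ z≈ → proj₁ z≈
      }

    open Func (proj₁ choice) renaming (to to choose; cong to choose-cong)

    -- The chosen approximation carries its own sequence, equal to `a` only pointwise; branches are
    -- compared through that sequence.
    index : (ℕ → Bool) → ℕ → Bool
    index a = proj₁ (choose a)

    close : ∀ {x y h h′} → h ≈ᴳ h′ → p ∈ Upper (H (x ⁻¹ ∙ h)) → p ∈ Upper (H (y ⁻¹ ∙ h′)) →
      r ∈ Upper (H (x ⁻¹ ∙ y))
    close {x} {y} {h} {h′} h≈h′ xh<p yh′<p =
      H-mono 2p≤r (H-resp path (H-product xh<p (H-inverse yh′<p)))
      where
      path : x ⁻¹ ∙ h ∙ (y ⁻¹ ∙ h′) ⁻¹ ≈ᴳ x ⁻¹ ∙ y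
      path = trans (assoc _ _ _) (∙-congˡ (trans
        (∙-congˡ (trans (⁻¹-anti-homo-∙ (y ⁻¹) h′) (∙-cong (⁻¹-cong (sym h≈h′)) (⁻¹-involutive y))))
        (\\-leftDividesˡ h y)))

    clash : (u v : Approximation) → proj₁ (proj₂ u) ≈ᴳ proj₁ (proj₂ v) →
      ∀ n → prefix (proj₁ u) n ≡ prefix (proj₁ v) n → ¬ (proj₁ u n ≢ proj₁ v n)
    clash (a , _ , _ , x , x∈ , xh<p) (b , _ , _ , y , y∈ , yh′<p) h≈h′ n e aₙ≢bₙ
      with a n in aₙ | b n in bₙ
    ... | false | false = aₙ≢bₙ refl
    ... | true  | true  = aₙ≢bₙ refl
    ... | false | true  = separates n e aₙ bₙ x∈ y∈ (close h≈h′ xh<p yh′<p)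
    ... | true  | false = separates n (≡.sym e) bₙ aₙ y∈ x∈ (close (sym h≈h′) yh′<p xh<p)

    injective : ∀ {a b} → proj₁ (proj₂ (choose a)) ≈ᴳ proj₁ (proj₂ (choose b)) → ∀ n → a n ≡ b n
    injective {a} {b} h≈h′ n = ≡.trans (≡.sym (proj₂ choice a n))
      (≡.trans (byContradiction em same) (proj₂ choice b n))
      where
      same : ¬ (index a n ≢ index b n)
      same aₙ≢bₙ
        with m , e , aₘ≢bₘ ← first-difference (index a) (index b) (suc n) (λ e → aₙ≢bₙ (List.∷-injectiveˡ e)) =
        clash (choose a) (choose b) h≈h′ m e aₘ≢bₘ

    injection : Injection 2^ℵ₀ (subset setoid D)
    injection = record
      { to        = λ a → let (_ , h , h∈D , _) = choose a in h , h∈D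
      ; cong      = λ a≗b → proj₂ (choose-cong a≗b)
      ; injective = injective
      }

-- Mycielski's theorem for the relation given by a meagre set of quotients.

module Mycielski (em : ∀ {ℓ} → ExcludedMiddle ℓ) {G : Group 0ℓ 0ℓ} {τ : Topology (Group.setoid G)}
  (isPolishGroup : IsPolishGroup G τ) where
  open Group G hiding (refl) renaming (_≈_ to _≈ᴳ_)
  open Algebra.Properties.Group G
  open PolishGroup isPolishGroup
  open Topology τ
  open Category em τ

  record Nbhd : Set where
    constructor nbhd
    field
      centre : Carrier
      radius : ℚ
      pos    : 0ℚ ℚ.< radius

  open Nbhd

  ⟦_⟧ : Nbhd → Pred Carrier 0ℓ
  ⟦ u ⟧ = B ρ (centre u) (radius u)

  ⟦⟧-open : ∀ u → Open ⟦ u ⟧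
  ⟦⟧-open u = ball-open (centre u) (radius u)

  centre∈ : ∀ u → centre u ∈ ⟦ u ⟧
  centre∈ u = B-refl ρ (centre u) (pos u)

  infix 4 _⊑_
  record _⊑_ (u v : Nbhd) : Set where
    constructor refines
    field
      sub     : ⟦ u ⟧ ⊆ ⟦ v ⟧
      radius≤ : radius u ℚ.≤ radius v

  open _⊑_

  ⊑-refl : ∀ {u} → u ⊑ u
  ⊑-refl = refines (λ x∈ → x∈) ℚ.≤-refl

  ⊑-trans : ∀ {u v w} → u ⊑ v → v ⊑ w → u ⊑ w
  ⊑-trans p q = refines (λ x∈ → sub q (sub p x∈)) (ℚ.≤-trans (radius≤ p) (radius≤ q))

  opaque
    refine : ∀ u {V} → Open V → ∀ {x} → x ∈ ⟦ u ⟧ → x ∈ V → ∃[ v ] (v ⊑ u × ⟦ v ⟧ ⊆ V)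
    refine u oV {x} x∈u x∈V
      with q , 0<q , q⊆ ← inner-ball (Open-∩ (⟦⟧-open u) oV) (x∈u , x∈V) =
      nbhd x (q ℚ.⊓ radius u) (0<⊓ q (radius u) 0<q (pos u)) ,
      refines (λ y∈ → proj₁ (q⊆ (B-mono ρ (ℚ.p⊓q≤p q (radius u)) y∈))) (ℚ.p⊓q≤q q (radius u)) ,
      λ y∈ → proj₂ (q⊆ (B-mono ρ (ℚ.p⊓q≤p q (radius u)) y∈))

    -- Since every refinement of the quarter ball is an admissible child, separation can be enforced
    -- afterwards without spoiling `Shrinks`.
    quarter : ∀ u → ∃[ v ] (∀ {w} → w ⊑ v → Shrinks ρ (centre u , radius u) (centre w , radius w))
    quarter u
      with p , 0<p , 2p≤q ← halve (pos u)
      with r , 0<r , 2r≤p ← halve 0<p =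
      nbhd (centre u) r 0<r , λ {w} w⊑ → r , sub w⊑ (centre∈ w) ,
        ℚ.≤-trans (ℚ.+-mono-≤ (ℚ.≤-trans (p≤q+p 0<r) 2r≤p)
                              (ℚ.≤-trans (ℚ.+-mono-≤ (radius≤ w⊑) (radius≤ w⊑)) 2r≤p)) 2p≤q

    -- The quotients by `centre u` of points of `v` form an open set. A non-empty open part `W` of
    -- it misses `N`, and continuity of the quotient keeps nearby pairs in `W`.
    separate : ∀ {N : Pred Carrier 0ℓ} → NowhereDense N → ∀ u v →
      ∃[ u′ ] ∃[ v′ ] (u′ ⊑ u × v′ ⊑ v × (∀ {x y} → x ∈ ⟦ u′ ⟧ → y ∈ ⟦ v′ ⟧ → x ⁻¹ ∙ y ∉ N))
    separate nd u v
      with W , W∩N ← nowhereDense⁻ nd (∙ˡ-continuous (centre u) ⟦ v ⟧ (⟦⟧-open v)) {centre u ⁻¹ ∙ centre v}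
                       (Open-≈ (⟦⟧-open v) (sym (\\-leftDividesˡ (centre u) (centre v))) (centre∈ v))
      with A , A′ , oA , oA′ , x∈A , y∈A′ , A⁻¹A′⊆W ←
             \\-nbhds (OpenIn.open′ W) {centre u} {centre u ∙ OpenIn.point W}
                       (Open-≈ (OpenIn.open′ W) (sym (\\-leftDividesʳ (centre u) (OpenIn.point W))) (OpenIn.point∈ W))
      with u′ , u′⊑u , u′⊆A  ← refine u oA (centre∈ u) x∈A
      with v′ , v′⊑v , v′⊆A′ ← refine v oA′ (OpenIn.⊆V W (OpenIn.point∈ W)) y∈A′ =
      u′ , v′ , u′⊑u , v′⊑v , λ x∈ y∈ → W∩N (A⁻¹A′⊆W (u′⊆A x∈) (v′⊆A′ y∈))

  Family : Set
  Family = List Bool → Nbhd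

  infix 4 _⊑ᶠ_
  _⊑ᶠ_ : Family → Family → Set
  F ⊑ᶠ F′ = ∀ s → F s ⊑ F′ s

  opaque
    update : List Bool → Nbhd → Family → Family
    update s u F r with List.≡-dec Bool._≟_ r s
    ... | yes _ = u
    ... | no _  = F r

    update-at : ∀ s u F → update s u F s ⊑ u
    update-at s u F with List.≡-dec Bool._≟_ s s
    ... | yes _  = ⊑-refl
    ... | no s≢s = ⊥-elim (s≢s refl)

    update-away : ∀ s u F {r} → r ≢ s → update s u F r ≡ F r
    update-away s u F {r} r≢s with List.≡-dec Bool._≟_ r s
    ... | yes r≡s = ⊥-elim (r≢s r≡s)
    ... | no _    = refl

    update-⊑ : ∀ s u F → u ⊑ F s → update s u F ⊑ᶠ F
    update-⊑ s u F u⊑ r with List.≡-dec Bool._≟_ r s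
    ... | yes refl = u⊑
    ... | no _     = ⊑-refl

  words : ℕ → List (List Bool)
  words zero    = [] ∷ []
  words (suc n) = map (false ∷_) (words n) ++ map (true ∷_) (words n)

  ∈-words : ∀ s → s ∈ₗ words (length s)
  ∈-words []          = here refl
  ∈-words (false ∷ s) = ∈-++⁺ˡ (∈-map⁺ (false ∷_) (∈-words s))
  ∈-words (true  ∷ s) = ∈-++⁺ʳ (map (false ∷_) (words (length s))) (∈-map⁺ (true ∷_) (∈-words s))

  module _ (N : ℕ → Pred Carrier 0ℓ) (nd : ∀ k → NowhereDense (N k)) where

    Constraint : Set
    Constraint = (List Bool × List Bool) × ℕ

    Satisfies : Family → Constraint → Set
    Satisfies F ((s , t) , k) = s ≢ t → ∀ {x y} → x ∈ ⟦ F s ⟧ → y ∈ ⟦ F t ⟧ → x ⁻¹ ∙ y ∉ N k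

    Satisfies-⊑ : ∀ {F F′} → F′ ⊑ᶠ F → ∀ {c} → Satisfies F c → Satisfies F′ c
    Satisfies-⊑ F′⊑F {(s , t) , k} sat s≢t x∈ y∈ = sat s≢t (sub (F′⊑F s) x∈) (sub (F′⊑F t) y∈)

    opaque
      -- As the words differ, neither update disturbs the other.
      enforce-separation : ∀ F {s t k} → s ≢ t → ∀ {u v} → u ⊑ F s → v ⊑ F t →
        (∀ {x y} → x ∈ ⟦ u ⟧ → y ∈ ⟦ v ⟧ → x ⁻¹ ∙ y ∉ N k) →
        ∃[ F′ ] (F′ ⊑ᶠ F × Satisfies F′ ((s , t) , k))
      enforce-separation F {s} {t} s≢t {u} {v} u⊑ v⊑ disjoint =
        F₂ ,
        (λ r → ⊑-trans (update-⊑ s u F₁ (subst (u ⊑_) (≡.sym (update-away t v F s≢t)) u⊑) r) (update-⊑ t v F v⊑ r)) ,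
        λ _ x∈ y∈ → disjoint (sub (update-at s u F₁) x∈)
          (sub (update-at t v F) (subst (λ w → _ ∈ ⟦ w ⟧) (update-away s u F₁ (λ t≡s → s≢t (≡.sym t≡s))) y∈))
        where
        F₁ F₂ : Family
        F₁ = update t v F
        F₂ = update s u F₁

      enforce₁ : ∀ F c → ∃[ F′ ] (F′ ⊑ᶠ F × Satisfies F′ c)
      enforce₁ F ((s , t) , k) with em {P = s ≡ t}
      ... | yes s≡t = F , (λ _ → ⊑-refl) , λ s≢t → ⊥-elim (s≢t s≡t)
      ... | no s≢t  = let (u , v , u⊑ , v⊑ , disjoint) = separate {N k} (nd k) (F s) (F t) in
        enforce-separation F {s} {t} {k} s≢t u⊑ v⊑ disjoint

      enforce : ∀ F cs → ∃[ F′ ] (F′ ⊑ᶠ F × All (Satisfies F′) cs)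
      enforce F []       = F , (λ _ → ⊑-refl) , []
      enforce F (c ∷ cs)
        with F₁ , F₁⊑F , sats ← enforce F cs
        with F₂ , F₂⊑F₁ , sat ← enforce₁ F₁ c =
        F₂ , (λ s → ⊑-trans (F₂⊑F₁ s) (F₁⊑F s)) , sat ∷ All.map (λ {c} → Satisfies-⊑ F₂⊑F₁ {c}) sats

    -- Finitely many at each level, yet each `N k` is treated at every level beyond `k`.
    constraints : ℕ → List Constraint
    constraints n = cartesianProduct (cartesianProduct (words n) (words n)) (upTo n)

    -- Both children start from the same ball; it is `enforce` that pulls them apart.
    extend : Family → Family
    extend F []      = F []
    extend F (_ ∷ s) = proj₁ (quarter (F s))

    level : ℕ → Family
    level zero    = λ _ → nbhd ε 1ℚ (ℚ.positive⁻¹ 1ℚ)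
    level (suc n) = proj₁ (enforce (extend (level n)) (constraints (suc n)))

    tree : Family
    tree s = level (length s) s

    scheme : CantorScheme ρ
    scheme = record
      { ball    = λ s → centre (tree s) , radius (tree s)
      ; pos     = λ s → pos (tree s)
      ; shrinks = λ i s → proj₂ (quarter (tree s)) (proj₁ (proj₂ (enforce (extend (level (length s))) _)) (i ∷ s))
      }

    open CantorScheme scheme hiding (pos)

    level-satisfies : ∀ {n k} → k ℕ.< suc n → ∀ {s t} → length s ≡ suc n → length t ≡ suc n →
      Satisfies (level (suc n)) ((s , t) , k)
    level-satisfies {n} k<n {s} {t} es et = All.lookup
      (proj₂ (proj₂ (enforce (extend (level n)) (constraints (suc n)))))
      (∈-cartesianProduct⁺ (∈-cartesianProduct⁺ (subst (λ n → s ∈ₗ words n) es (∈-words s))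
                                                (subst (λ n → t ∈ₗ words n) et (∈-words t))) (∈-upTo⁺ k<n))

    branches-separated : ∀ {a b m} → prefix a m ≢ prefix b m → ∀ {x y} → x ∈ Branch a → y ∈ Branch b →
      ∀ k → x ⁻¹ ∙ y ∉ N k
    branches-separated {a} {b} {m} a≢b {x} {y} x∈ y∈ k =
      level-satisfies (ℕ.s≤s (ℕ.m≤m+n k m)) (length-prefix a n) (length-prefix b n)
        (prefix-≢ a b a≢b (suc k)) (at a x∈) (at b y∈)
      where
      n : ℕ
      -- Beyond `m`, so that the words still differ, and beyond `k`, so that `N k` is among the
      -- constraints.
      n = suc k ℕ.+ m
      at : ∀ a {x} → x ∈ Branch a → x ∈ ⟦ level n (prefix a n) ⟧
      at a {x} x∈ = subst (λ l → x ∈ ⟦ level l (prefix a n) ⟧) (length-prefix a n) (x∈ n)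

  separated-scheme : ∀ {a} {A : Pred Carrier a} → Meagre A →
    Σ[ T ∈ CantorScheme ρ ] CantorScheme.Separates T (λ x y → x ⁻¹ ∙ y ∉ A)
  separated-scheme (N , nd , A⊆N) = scheme N nd , λ {a} {b} n _ aₙ bₙ x∈ y∈ x⁻¹y∈A →
    let (k , x⁻¹y∈N) = A⊆N x⁻¹y∈A in
    branches-separated N nd {a} {b} {suc n}
      (λ e → false≢true (≡.trans (≡.sym aₙ) (≡.trans (List.∷-injectiveˡ e) bₙ)))
      x∈ y∈ k x⁻¹y∈N
    where
    false≢true : false ≢ true
    false≢true ()

-- Extending generic tuples by means of ample generics.

module Ample (em : ∀ {ℓ} → ExcludedMiddle ℓ) (𝔾 : PolishTopometricGroup) (ample : AmpleGenerics 𝔾) where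
  open PolishTopometricGroup 𝔾
  open Group group hiding (refl; Carrier; _∙_; ε; _⁻¹; setoid) renaming (_≈_ to _≈ᴳ_)
  open Algebra.Properties.Group group
  open PolishGroup isPolishGroup
  open Topology τ
  open Category em τ

  conj : Carrier → Carrier → Carrier
  conj k g = k ∙ g ∙ k ⁻¹

  conj-cong : ∀ {k l g h} → k ≈ᴳ l → g ≈ᴳ h → conj k g ≈ᴳ conj l h
  conj-cong k≈l g≈h = ∙-cong (∙-cong k≈l g≈h) (⁻¹-cong k≈l)

  conj-∙ : ∀ k l g → conj (k ∙ l) g ≈ᴳ conj k (conj l g)
  conj-∙ k l g = trans (∙-congˡ (⁻¹-anti-homo-∙ k l)) (trans (sym (assoc _ _ _))
    (∙-congʳ (trans (assoc (k ∙ l) g (l ⁻¹)) (trans (assoc k l (g ∙ l ⁻¹)) (∙-congˡ (sym (assoc l g (l ⁻¹))))))))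

  ∂-resp : ∀ {x x′ y y′ q} → x ≈ᴳ x′ → y ≈ᴳ y′ → y ∈ B ∂ x q → y′ ∈ B ∂ x′ q
  ∂-resp x≈x′ y≈y′ = proj₂ (Metric.cong ∂ x≈x′ y≈y′)

  conj-isometry : ∀ k {x y q} → y ∈ B ∂ x q → conj k y ∈ B ∂ (conj k x) q
  conj-isometry k {x} {y} xy<q = proj₁ (∂-invariantʳ (k ⁻¹) (k ∙ x) (k ∙ y)) (proj₁ (∂-invariantˡ k x y) xy<q)

  conj-isometry⁻ : ∀ h k {x y q} → conj k y ∈ B ∂ (conj h x) q → conj (h ⁻¹ ∙ k) y ∈ B ∂ x q
  conj-isometry⁻ h k {x} {y} hk<q = ∂-resp h⁻¹hx≈x (sym (conj-∙ (h ⁻¹) k y)) (conj-isometry (h ⁻¹) hk<q)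
    where
    h⁻¹hx≈x : conj (h ⁻¹) (conj h x) ≈ᴳ x
    h⁻¹hx≈x = trans (sym (conj-∙ (h ⁻¹) h x)) (trans (conj-cong (inverseˡ h) (Setoid.refl setoid))
      (trans (∙-cong (identityˡ x) ε⁻¹≈ε) (identityʳ x)))

  infix 4 _≤∂_
  -- The bound is non-strict, so that lower semicontinuity of `∂` makes it a closed condition.
  _≤∂_ : Carrier × Carrier → Σ[ q ∈ ℚ ] 0ℚ ℚ.< q → Set
  (x , y) ≤∂ (q , 0<q) = Metric.dist ∂ x y ≤ cut q 0<q

  generators : ∀ n → Fin n → Carrier
  generators n = proj₁ (ample n)

  ∷-continuous : ∀ {n} (x : Fin n → Carrier) i → Continuous τ τ (λ y → (y Vec.∷ x) i)
  ∷-continuous x zero    = id-continuous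
  ∷-continuous x (suc i) = const-continuous (x i)

  OrbitClosure : ∀ {n} → Pred (Fin n → Carrier) _
  OrbitClosure {n} = Topology.Closure (Metric.topology (maxMetric ∂ n)) (DiagonalConjugates 𝔾 (generators n))

  approximant : ∀ {n} {x : Fin n → Carrier} → x ∈ OrbitClosure → ∀ {q} → 0ℚ ℚ.< q →
    ∃[ k ] (∀ i → x i ∈ B ∂ (conj k (generators n i)) q)
  approximant {n} {x} x∈ {q} 0<q
    with y , xy<q , k , y≈ ←
           x∈ (B (maxMetric ∂ n) x q) (B-open (maxMetric ∂ n) x q) (B-refl (maxMetric ∂ n) x 0<q) =
    k , λ i → B-sym ∂ (∂-resp (Setoid.refl setoid) (y≈ i) (maximum⁻ (λ i → Metric.dist ∂ (x i) (y i)) xy<q i))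

  -- S k n x says that the extensions of x by k points generically lie in the orbit closure.
  S : ℕ → ∀ n → Pred (Fin n → Carrier) (Level.suc 0ℓ)
  S zero    n x = x ∈ OrbitClosure
  S (suc k) n x = Meagre (λ y → ¬ S k (suc n) (y Vec.∷ x))

  S-comeagre : ∀ k n → Topology.CoMeagre (power τ n) (S k n)
  S-comeagre zero    n = proj₂ (ample n)
  S-comeagre (suc k) n = KuratowskiUlam.fibre-meagre em τ isBase (S-comeagre k (suc n))

  Gen : ∀ {n} → Pred (Fin n → Carrier) (Level.suc 0ℓ)
  Gen {n} x = ∀ k → S k n x

  -- Condition k + 1 on `x` bounds the failures of condition `k` among its extensions. Asking for
  -- all `k` at once makes genericity pass on.
  Gen-∷ : ∀ {n} {x : Fin n → Carrier} → Gen x → Meagre (λ y → ¬ Gen (y Vec.∷ x))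
  Gen-∷ {n} {x} gen = meagre-⊆ (¬∀⇒∃¬ em) (meagre-⋃ {A = λ k y → ¬ S k (suc n) (y Vec.∷ x)} λ k → gen (suc k))

  -- The power with exponent 0 has a single point, and a nowhere dense set cannot contain it.
  Gen-[] : Gen Vec.[]
  Gen-[] k = byContradiction em λ ¬S →
    let (N , nd , cover) = S-comeagre k 0
        (j , ∈N) = cover ¬S
    in nd j U (λ {x} → Topology.Open-U (power τ 0) {x})
         (λ {x} _ W oW x∈W → Vec.[] ,
           Topology.Open-≈ (power τ 0) {W} (λ {y} → oW {y}) {x} {Vec.[]} (λ ()) x∈W , ∈N) Vec.[] _

  module Step {n} (x : Fin n → Carrier) (gen : Gen x) {e} (0<e : 0ℚ ℚ.< e) where

    F : Pred (Carrier × Carrier) 0ℓ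
    F (f , y) = ∀ i → (conj f (generators (suc n) i) , (y Vec.∷ x) i) ≤∂ (e , 0<e)

    F-closed : Topology.Closed (τ ⊗ τ) F
    F-closed {f} {y} ¬F
      with i , ¬close ← ¬∀⇒∃¬ em ¬F
      with A , A′ , oA , oA′ , ∈A , ∈A′ , far ← ∂-lsc (cut e 0<e) ¬close =
      (λ f → conj f (generators (suc n) i) ∈ A) , (λ y → (y Vec.∷ x) i ∈ A′) ,
      conj-continuous _ A oA , ∷-continuous x i A′ oA′ , ∈A , ∈A′ , λ ∈A ∈A′ F → far ∈A ∈A′ (F i)

    open Projection em (IsPolishGroup.isPolish isPolishGroup) τ isBase F F-closed

    -- The two sets differ in direction: `y` has to pass from an image to its `Ess`, and `z` back
    -- from that `Ess` to the image.
    Exceptional Exceptional′ : Pred Carrier (Level.suc 0ℓ)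
    Exceptional  y = ¬ Gen (y Vec.∷ x) ⊎ (∃[ m ] (y ∈ Image m × y ∉ Ess isBase (Image m)))
    Exceptional′ z = ¬ Gen (z Vec.∷ x) ⊎ (∃[ m ] (z ∈ Ess isBase (Image m) × z ∉ Image m))

    opaque
      Exceptional-meagre : Meagre Exceptional
      Exceptional-meagre = meagre-∪ (Gen-∷ gen)
        (meagre-⋃ {A = λ m y → y ∈ Image m × y ∉ Ess isBase (Image m)} (λ m → A∖Ess-meagre isBase (Image m)))

      Exceptional′-meagre : Meagre Exceptional′
      Exceptional′-meagre = meagre-∪ (Gen-∷ gen) Ess∖Image-meagre

      piece : ∀ {W} → Open W → ε ∈ W → ∀ {y} → y ∉ Exceptional →
        ∃[ m ] ((∀ {f f′} → f ∈ b m → f′ ∈ b m → f ∙ f′ ⁻¹ ∈ W) × y ∈ Image m × y ∈ Ess isBase (Image m))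
      piece oW ε∈W {y} y∉ =
        let (f , close) = approximant (byContradiction em (λ ¬gen → y∉ (inj₁ ¬gen)) 0) 0<e
            (m , f∈b , small) = small-quotients oW ε∈W f
            y∈ : y ∈ Image m
            y∈ = f , f∈b , λ i {q} e<q → B-mono ∂ (ℚ.<⇒≤ e<q) (close i)
        in m , small , y∈ , byContradiction em {P = y ∈ Ess isBase (Image m)}
             (λ y∉Ess → y∉ (inj₂ (m , y∈ , y∉Ess)))

      -- Both tuples nearly are conjugates of the same generators, by `f` and by `f′`, and
      -- conjugation preserves `∂`. Passing from `e` to the larger `p` makes the bounds strict.
      transport : ∀ {p} → e ℚ.< p → ∀ {f f′ y z} → (f , y) ∈ F → (f′ , z) ∈ F →
        ∀ i → conj (f ∙ f′ ⁻¹) ((z Vec.∷ x) i) ∈ B ∂ ((y Vec.∷ x) i) (p ℚ.+ p)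
      transport e<p {f} {f′} Ffy Ff′z i = B-triangle ∂ (B-sym ∂ (Ffy i e<p))
        (∂-resp (back (generators (suc n) i)) (Setoid.refl setoid) (conj-isometry (f ∙ f′ ⁻¹) (Ff′z i e<p)))
        where
        back : ∀ g → conj (f ∙ f′ ⁻¹) (conj f′ g) ≈ᴳ conj f g
        back g = trans (sym (conj-∙ (f ∙ f′ ⁻¹) f′ g)) (conj-cong (//-rightDividesˡ f′ f) (Setoid.refl setoid))

    module _ {A A′ V W : Pred Carrier 0ℓ} (oV : Open V) (A-nonmeagre : ¬ Meagre (λ y → y ∈ A × y ∈ V))
      (A′-nonmeagre : EverywhereNonmeagre A′ V) (oW : Open W) (ε∈W : ε ∈ W) {p : ℚ} (e<p : e ℚ.< p) where

      Step : Set₁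
      Step = ∃[ y ] ∃[ z ] ∃[ w ] (y ∈ A × z ∈ A′ × w ∈ W × Gen (y Vec.∷ x) × Gen (z Vec.∷ x) ×
        (∀ i → conj w ((z Vec.∷ x) i) ∈ B ∂ ((y Vec.∷ x) i) (p ℚ.+ p)))

      opaque
        -- A generic `y` lies in the image of a piece of conjugators with quotients in `W`, and in
        -- the open `Ess` of this image. There `A′` is non-meagre, so it has a generic point `z`,
        -- which is reached by a conjugator from the same piece.
        step : Step
        step = pick-y (generic A-nonmeagre Exceptional-meagre)
          where
          module _ {y} (y∈A : y ∈ A) (y∉ : y ∉ Exceptional) {m}
            (small : ∀ {f f′} → f ∈ b m → f′ ∈ b m → f ∙ f′ ⁻¹ ∈ W) (y∈Image : y ∈ Image m) where

            pick-z : ∃[ z ] ((z ∈ A′ × z ∈ V × z ∈ Ess isBase (Image m)) × z ∉ Exceptional′) → Step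
            pick-z (z , (z∈A′ , z∈V , z∈Ess) , z∉) =
              let (f , f∈b , Ffy) = y∈Image
                  (f′ , f′∈b , Ff′z) = byContradiction em (λ z∉Image → z∉ (inj₂ (m , z∈Ess , z∉Image)))
              in y , z , f ∙ f′ ⁻¹ , y∈A , z∈A′ , small f∈b f′∈b ,
                 byContradiction em (λ ¬gen → y∉ (inj₁ ¬gen)) , byContradiction em (λ ¬gen → z∉ (inj₁ ¬gen)) ,
                 transport e<p Ffy Ff′z

          pick-y : ∃[ y ] ((y ∈ A × y ∈ V) × y ∉ Exceptional) → Step
          pick-y (y , (y∈A , y∈V) , y∉) =
            let (m , small , y∈Image , y∈Ess) = piece oW ε∈W y∉
                near-y = record { set = V ∩ Ess isBase (Image m)
                                ; open′ = Open-∩ oV (Ess-open isBase {A = Image m})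
                                ; point = y ; point∈ = y∈V , y∈Ess ; ⊆V = proj₁ }
            in pick-z y∈A y∉ {m} small y∈Image (generic (A′-nonmeagre near-y) Exceptional′-meagre)

-- The binary tree of conjugators.

module Tree (em : ∀ {ℓ} → ExcludedMiddle ℓ) (𝔾 : PolishTopometricGroup) (ample : AmpleGenerics 𝔾) where
  open PolishTopometricGroup 𝔾
  open Group group hiding (refl; Carrier; _∙_; ε; _⁻¹; setoid) renaming (_≈_ to _≈ᴳ_)
  open Algebra.Properties.Group group
  open PolishGroup isPolishGroup
  open Topology τ
  open Category em τ
  open Ample em 𝔾 ample

  module Splitting {A A′ V : Pred Carrier 0ℓ} (oV : Open V) (A-nonmeagre : ¬ Meagre (λ y → y ∈ A × y ∈ V))
    (A′-nonmeagre : EverywhereNonmeagre A′ V) {E} (0<E : 0ℚ ℚ.< E) where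

    -- `tuple` collects the points chosen so far on the branch, and `error` bounds how far their
    -- conjugates by `centre` may still move in `∂` further down.
    record Node (n : ℕ) : Set₁ where
      field
        centre     : Carrier
        radius     : ℚ
        0<radius   : 0ℚ ℚ.< radius
        tuple      : Fin n → Carrier
        tuple-gen  : Gen tuple
        error      : ℚ
        0<error    : 0ℚ ℚ.< error
        error≤     : error ℚ.≤ E

    open Node

    root : Node 0
    root = record
      { centre = ε ; radius = 1ℚ ; 0<radius = ℚ.positive⁻¹ 1ℚ ; tuple = Vec.[] ; tuple-gen = Gen-[]
      ; error = E ; 0<error = 0<E ; error≤ = ℚ.≤-refl }

    record Split {n} (N : Node n) : Set₁ where
      field
        half-radius quarter-radius half-error : ℚ
        0<half-radius    : 0ℚ ℚ.< half-radius
        half-radius≤     : half-radius ℚ.+ half-radius ℚ.≤ radius N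
        0<quarter-radius : 0ℚ ℚ.< quarter-radius
        quarter-radius≤  : quarter-radius ℚ.+ quarter-radius ℚ.≤ half-radius
        0<half-error     : 0ℚ ℚ.< half-error
        half-error≤      : half-error ℚ.+ half-error ℚ.≤ error N
        y z w            : Carrier
        y∈A              : y ∈ A
        z∈A′             : z ∈ A′
        w-small          : centre N ∙ w ∈ B ρ (centre N) half-radius
        y-gen            : Gen (y Vec.∷ tuple N)
        z-gen            : Gen (z Vec.∷ tuple N)
        w-moves          : ∀ i → conj w ((z Vec.∷ tuple N) i) ∈ B ∂ ((y Vec.∷ tuple N) i) half-error

    opaque
      split : ∀ {n} (N : Node n) → Split N
      split N =
        let (r , 0<r , 2r≤) = halve (0<radius N)
            (r′ , 0<r′ , 2r′≤) = halve 0<r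
            (h , 0<h , 2h≤) = halve (0<error N)
            -- `step` delivers the bound 2p and asks for a tolerance `e` strictly below `p`.
            (p , 0<p , 2p≤h) = halve 0<h
            (e , 0<e , 2e≤p) = halve 0<p
            (y , z , w , y∈A , z∈A′ , w∈W , y-gen , z-gen , moves) =
              Step.step (tuple N) (tuple-gen N) 0<e {A} {A′} {V} {λ w → centre N ∙ w ∈ B ρ (centre N) r}
                oV A-nonmeagre A′-nonmeagre
                (∙ˡ-continuous (centre N) _ (ball-open (centre N) r))
                (Open-≈ (ball-open (centre N) r) (sym (identityʳ (centre N))) (B-refl ρ (centre N) 0<r))
                (ℚ.<-≤-trans (p<p+p 0<e) 2e≤p)
        in record
          { half-radius = r ; quarter-radius = r′ ; half-error = h
          ; 0<half-radius = 0<r ; half-radius≤ = 2r≤ ; 0<quarter-radius = 0<r′ ; quarter-radius≤ = 2r′≤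
          ; 0<half-error = 0<h ; half-error≤ = 2h≤
          ; y = y ; z = z ; w = w ; y∈A = y∈A ; z∈A′ = z∈A′ ; w-small = w∈W ; y-gen = y-gen ; z-gen = z-gen
          ; w-moves = λ i → B-mono ∂ 2p≤h (moves i) }

    module _ {n} (N : Node n) where
      open Split (split N)

      half-error≤E : half-error ℚ.≤ E
      half-error≤E = ℚ.≤-trans (p≤q+p 0<half-error) (ℚ.≤-trans half-error≤ (error≤ N))

      -- Conjugation by `w` nearly fixes the old tuple and nearly takes `z` to `y`. So both children
      -- conjugate the old points alike, and the right one sends `z` near to where the left one
      -- sends `y`.
      child : Bool → Node (suc n)
      child false = record
        { centre = centre N ; radius = quarter-radius ; 0<radius = 0<quarter-radius
        ; tuple = y Vec.∷ tuple N ; tuple-gen = y-gen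
        ; error = half-error ; 0<error = 0<half-error ; error≤ = half-error≤E }
      child true = record
        { centre = centre N ∙ w ; radius = quarter-radius ; 0<radius = 0<quarter-radius
        ; tuple = z Vec.∷ tuple N ; tuple-gen = z-gen
        ; error = half-error ; 0<error = 0<half-error ; error≤ = half-error≤E }

      child-shrinks : ∀ i → Shrinks ρ (centre N , radius N) (centre (child i) , radius (child i))
      child-shrinks false = half-radius , B-refl ρ (centre N) 0<half-radius ,
        ℚ.≤-trans (ℚ.+-monoʳ-≤ half-radius quarter-radius≤) half-radius≤
      child-shrinks true  = half-radius , w-small ,
        ℚ.≤-trans (ℚ.+-monoʳ-≤ half-radius quarter-radius≤) half-radius≤

      child-error : ∀ i → error (child i) ℚ.+ error (child i) ℚ.≤ error N
      child-error false = half-error≤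
      child-error true  = half-error≤

      child-tuple : ∀ i j → tuple (child i) (suc j) ≡ tuple N j
      child-tuple false j = refl
      child-tuple true  j = refl

      child-moves : ∀ i j →
        conj (centre (child i)) (tuple N j) ∈ B ∂ (conj (centre N) (tuple N j)) (error (child i))
      child-moves false j = B-refl ∂ _ 0<half-error
      child-moves true  j = ∂-resp (Setoid.refl setoid) (sym (conj-∙ (centre N) w _))
        (conj-isometry (centre N) (w-moves (suc j)))

    tree : (s : List Bool) → Node (length s)
    tree []      = root
    tree (i ∷ s) = child (tree s) i

    scheme : CantorScheme ρ
    scheme = record
      { ball    = λ s → centre (tree s) , radius (tree s)
      ; pos     = λ s → 0<radius (tree s)
      ; shrinks = λ i s → child-shrinks (tree s) i
      }

    open CantorScheme scheme hiding (shrinks)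

    infix 4 _∈ᵗ_
    -- Tuples grow at the front, which shifts indices at every level; naming a point by its value
    -- keeps it fixed along the branch.
    _∈ᵗ_ : Carrier → List Bool → Set
    x ∈ᵗ s = ∃[ j ] tuple (tree s) j ≡ x

    ∈ᵗ-∷ : ∀ {x s} i → x ∈ᵗ s → x ∈ᵗ i ∷ s
    ∈ᵗ-∷ {s = s} i (j , refl) = suc j , child-tuple (tree s) i j

    module _ (a : ℕ → Bool) where

      N : ∀ n → Node (length (prefix a n))
      N n = tree (prefix a n)

      -- A geometric series: the next step costs at most the error of the child, all later ones
      -- together at most as much again.
      moves : ∀ k n {x} → x ∈ᵗ prefix a n →
        conj (centre (N (k ℕ.+ n))) x ∈ B ∂ (conj (centre (N n)) x) (error (N n))
      moves zero    n _  = B-refl ∂ _ (0<error (N n))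
      moves (suc k) n {x} x∈@(j , refl) =
        subst (λ m → conj (centre (N m)) x ∈ B ∂ (conj (centre (N n)) x) (error (N n))) (ℕ.+-suc k n)
          (B-mono ∂ (child-error (N n) (a n))
            (B-triangle ∂ (child-moves (N n) (a n) j) (moves k (suc n) (∈ᵗ-∷ {s = prefix a n} (a n) x∈))))

      -- The centres converge to `h` in `τ` only; lower semicontinuity of `∂` carries their common
      -- bound over to `h`.
      moves-limit : ∀ {h} → h ∈ Branch a → ∀ n {x} → x ∈ᵗ prefix a n →
        ∀ {q} → error (N n) ℚ.< q → conj h x ∈ B ∂ (conj (centre (N n)) x) q
      moves-limit {h} h∈ n {x} x∈ = byContradiction em
        {P = (conj (centre (N n)) x , conj h x) ≤∂ (error (N n) , 0<error (N n))} far
        where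
        far : ¬ ¬ ((conj (centre (N n)) x , conj h x) ≤∂ (error (N n) , 0<error (N n)))
        far ¬close =
          let (T , T′ , oT , oT′ , ∈T , ∈T′ , disjoint) = ∂-lsc (cut (error (N n)) (0<error (N n))) ¬close
              (q , 0<q , q⊆) = inner-ball (conj-continuous x T′ oT′) ∈T′
              (k , k⊆) = shrinking-absorbed ρ _ (branch-shrinking a) h∈ 0<q
              later = shrinking-later ρ (λ n → ball (prefix a n)) (λ n → pos (prefix a n))
                        (branch-shrinking a) (ℕ.m≤m+n k n)
          in disjoint ∈T (q⊆ (k⊆ later)) λ {q} e<q → B-mono ∂ (ℚ.<⇒≤ e<q) (moves k n x∈)

    -- With `c` the centre at the split, `conj h y` is near `conj c y`, this is near
    -- `conj (c ∙ w) z`, and that is near `conj h′ z`. Conjugation by `h′ ⁻¹` finishes.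
    splits : ∀ {a a′} n → prefix a n ≡ prefix a′ n → a n ≡ false → a′ n ≡ true →
      ∀ {h h′} → h ∈ Branch a → h′ ∈ Branch a′ →
      ∃[ y ] ∃[ z ] (y ∈ A × z ∈ A′ × conj (h′ ⁻¹ ∙ h) y ∈ B ∂ z ((E ℚ.+ E) ℚ.+ (E ℚ.+ E)))
    splits {a} {a′} n e aₙ a′ₙ {h} {h′} h∈ h′∈ =
      y , z , y∈A , z∈A′ , conj-isometry⁻ h′ h (B-mono ∂ bound
        (B-triangle ∂ (B-sym ∂ h′z≈cwz) (B-triangle ∂ (B-sym ∂ cy≈cwz) hy≈cy)))
      where
      s = prefix a n
      P = tree s
      open Split (split P)

      at : ∀ c {i s} → s ≡ prefix c n → c n ≡ i → prefix c (suc n) ≡ i ∷ s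
      at c e refl = ≡.cong₂ _∷_ refl (≡.sym e)

      limit : ∀ {c g} → g ∈ Branch c → ∀ {i} → s ≡ prefix c n → c n ≡ i → ∀ {x} → x ∈ᵗ i ∷ s →
        ∀ {q} → error (child P i) ℚ.< q → conj g x ∈ B ∂ (conj (centre (child P i)) x) q
      limit {c} {g} g∈ e cₙ {x} = subst
        (λ t → x ∈ᵗ t → ∀ {q} → error (tree t) ℚ.< q → conj g x ∈ B ∂ (conj (centre (tree t)) x) q)
        (at c e cₙ) (moves-limit c g∈ (suc n))

      half-error<E+E : half-error ℚ.< E ℚ.+ E
      half-error<E+E = ℚ.≤-<-trans (half-error≤E P)
        (p<p+p 0<E)

      hy≈cy : conj h y ∈ B ∂ (conj (centre P) y) (half-error ℚ.+ half-error)
      hy≈cy = limit h∈ refl aₙ (zero , refl)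
        (p<p+p 0<half-error)

      h′z≈cwz : conj h′ z ∈ B ∂ (conj (centre P ∙ w) z) (E ℚ.+ E)
      h′z≈cwz = limit h′∈ e a′ₙ (zero , refl) half-error<E+E

      cy≈cwz : conj (centre P ∙ w) z ∈ B ∂ (conj (centre P) y) half-error
      cy≈cwz = ∂-resp (Setoid.refl setoid) (sym (conj-∙ (centre P) w z))
        (conj-isometry (centre P) (w-moves zero))

      bound : E ℚ.+ E ℚ.+ (half-error ℚ.+ (half-error ℚ.+ half-error)) ℚ.≤ E ℚ.+ E ℚ.+ (E ℚ.+ E)
      bound = ℚ.+-monoʳ-≤ (E ℚ.+ E) (ℚ.+-mono-≤ (half-error≤E P) (ℚ.≤-trans half-error≤ (error≤ P)))

-- The small density property.

module SmallDensity (em : ∀ {ℓ} → ExcludedMiddle ℓ) (ac : ∀ {a ℓ} → AxiomOfChoice a ℓ)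
  (𝔾 : PolishTopometricGroup) (ample : AmpleGenerics 𝔾) (𝓗 : GradedSubgroup (PolishTopometricGroup.group 𝔾))
  (lsc : Topology.LowerSemicontinuous (Metric.topology (PolishTopometricGroup.∂ 𝔾)) (GradedSubgroup.H 𝓗))
  (small-index : IndexLessThan 2^ℵ₀ 𝓗) where
  open PolishTopometricGroup 𝔾
  open Group group hiding (refl; Carrier; _∙_; ε; _⁻¹; setoid) renaming (_≈_ to _≈ᴳ_)
  open Algebra.Properties.Group group
  open PolishGroup isPolishGroup
  open Graded 𝓗
  open ContinuityAtIdentity isPolishGroup 𝓗
  open Topology τ
  open Category em τ
  open Index em ac ρ complete 𝓗 small-index

  nonmeagre : ∀ {u} → 0ℚ ℚ.< u → ¬ Meagre (λ g → u ∈ Upper (H g))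
  nonmeagre 0<u m = let (scheme , separates) = Mycielski.separated-scheme em isPolishGroup m in
    not-separated scheme 0<u separates

  Robust : ℚ → ℕ → Pred Carrier 0ℓ
  Robust v k x = ∀ {y} → y ∈ B ∂ x (dyadic k) → v ∉ Upper (H y)

  -- As `v` is below `s`, the point lies outside the `∂`-closed set where `H` is at most `v`. Dyadic
  -- radii leave only countably many sets to cover these points.
  robust : ∀ {v s} → 0ℚ ℚ.< v → v ℚ.< s → ∀ {x} → s ∉ Upper (H x) → ∃[ k ] x ∈ Robust v k
  robust {v} 0<v v<s {x} Hx≥s =
    let (q , 0<q , q⊆) = open⇒ball ∂ (lsc (cut v 0<v)) {x} (λ Hx≤v → Hx≥s (Hx≤v v<s))
        (k , ≤q) = dyadic-small 0<q
    in k , λ {y} y∈ Hy<v → q⊆ (B-mono ∂ ≤q y∈) (λ v<p → H-mono (ℚ.<⇒≤ v<p) Hy<v)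

  -- With g = h′⁻¹h for limits h, h′ of distinct branches, gyg⁻¹ is close to z and H (gyg⁻¹) ≤ 2 H g + H y.
  not-both-nonmeagre : ∀ {u} → 0ℚ ℚ.< u → ∀ {V} → Open V → ¬ Meagre (λ y → u ∈ Upper (H y) × y ∈ V) →
    ∀ k → ¬ EverywhereNonmeagre (Robust (u ℚ.+ u ℚ.+ u) k) V
  not-both-nonmeagre {u} 0<u oV A-nonmeagre k A′-nonmeagre =
    not-separated scheme 0<u separates
    where
    -- `splits` loses 4E, so E is a quarter of the robustness radius.
    E′ = halve (dyadic-pos k)
    E″ = halve (proj₁ (proj₂ E′))
    open Tree.Splitting em 𝔾 ample oV A-nonmeagre A′-nonmeagre (proj₁ (proj₂ E″))
    separates : CantorScheme.Separates scheme (λ x y → u ∉ Upper (H (x ⁻¹ ∙ y)))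
    separates n e aₙ a′ₙ {h} {h′} h∈ h′∈ H<u =
      let (y , z , Hy<u , z-robust , close) = splits n e aₙ a′ₙ h∈ h′∈
          2E≤ = proj₂ (proj₂ E″)
          g = h′ ⁻¹ ∙ h
          Hg<u : u ∈ Upper (H g)
          Hg<u = H-resp (trans (⁻¹-anti-homo-∙ (h ⁻¹) h′) (∙-congˡ (⁻¹-involutive h))) (H-inverse H<u)
      in z-robust (B-mono ∂ (ℚ.≤-trans (ℚ.+-mono-≤ 2E≤ 2E≤) (proj₂ (proj₂ E′))) close)
           (H-product (H-product Hg<u Hy<u) (H-inverse Hg<u))

  smallNearIdentity : ∀ {t} → 0ℚ ℚ.< t → SmallNearIdentity t
  smallNearIdentity {t} 0<t =
    -- Pettis' argument doubles `s`, whence s ≤ t/2; two more halvings give 4u ≤ s and thus 3u < s.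
    let (s , 0<s , 2s≤t) = halve 0<t
        (r , 0<r , 2r≤s) = halve 0<s
        (u , 0<u , 2u≤r) = halve 0<r
    in enlarge 2s≤t (byContradiction em (main 0<u (4u≤ 0<u 2u≤r 2r≤s)))
    where
    enlarge : ∀ {s t} → s ℚ.≤ t → SmallNearIdentity s → SmallNearIdentity t
    enlarge s≤t (V , oV , ε∈V , V⊆) = V , oV , ε∈V , λ g∈ → H-mono s≤t (V⊆ g∈)

    4u≤ : ∀ {u r s} → 0ℚ ℚ.< u → u ℚ.+ u ℚ.≤ r → r ℚ.+ r ℚ.≤ s → u ℚ.+ u ℚ.+ u ℚ.< s
    4u≤ {u} {r} 0<u 2u≤r 2r≤s = ℚ.<-≤-trans (ℚ.+-mono-≤-< 2u≤r
      (ℚ.<-≤-trans (p<p+p 0<u) 2u≤r)) 2r≤s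

    main : ∀ {u s} → 0ℚ ℚ.< u → u ℚ.+ u ℚ.+ u ℚ.< s → ¬ ¬ SmallNearIdentity (s ℚ.+ s)
    main {u} {s} 0<u 3u<s ¬small =
      let (V₁ , A-nonmeagre) = everywhereNonmeagre isBase {A = λ g → u ∈ Upper (H g)} Open-U
            (λ m → nonmeagre 0<u (meagre-⊆ (λ Hg<u → Hg<u , _) m))
          B-nonmeagre : ¬ Meagre (λ g → s ∉ Upper (H g) × g ∈ set V₁)
          B-nonmeagre m = ¬small (pettis em (open-nonmeagre em (nonmeagre 0<u)) (open′ V₁) (point∈ V₁) m)
          -- The sets `Robust` cover the points with H ≥ s, so one of them is non-meagre in `V₁`;
          -- this fixes a single radius.
          (k , ¬m) = ¬∀⇒∃¬ em λ m → B-nonmeagre (meagre-⊆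
            (λ (Hg≥s , g∈) → let (k , g-robust) = robust 0<3u 3u<s Hg≥s in k , g-robust , g∈)
            (meagre-⋃ {A = λ k g → g ∈ Robust (u ℚ.+ u ℚ.+ u) k × g ∈ set V₁} m))
          (V₂ , robust-nonmeagre) = everywhereNonmeagre isBase {A = Robust (u ℚ.+ u ℚ.+ u) k} (open′ V₁) ¬m
      in not-both-nonmeagre 0<u (open′ V₂) (A-nonmeagre V₂) k robust-nonmeagre
      where
      0<3u : 0ℚ ℚ.< u ℚ.+ u ℚ.+ u
      0<3u = ℚ.+-mono-< (ℚ.+-mono-< 0<u 0<u) 0<u

theorem4p4 : (∀ {ℓ} → ExcludedMiddle ℓ) →
    (∀ {a ℓ} → AxiomOfChoice a ℓ) →
    (𝔾 : PolishTopometricGroup) →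
    AmpleGenerics 𝔾 →
    SmallDensityProperty 𝔾
theorem4p4 em ac 𝔾 ample 𝓗 lsc small-index =
  upperSemicontinuous smallNearIdentity , continuous smallNearIdentity
  where
  open SmallDensity em ac 𝔾 ample 𝓗 lsc small-index
  open ContinuityAtIdentity (PolishTopometricGroup.isPolishGroup 𝔾) 𝓗
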